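{- Let $v$ be a leaf of the path $P_n$. Then, for $n\ge 4$, $$X_{P_{n,v}}=2(n+1)e_{n+1}+2\sum_{j=3}^{n}(j-1)e_jX_{P_{n+1-j}}.$$ Thus $X_{P_{n,v}}$ is $e$-positive. Moreover, for $n\ge 4$, $X_{P_{n,v}}$ satisfies the $e$-positive recurrence $$X_{P_{n,v}}=\sum_{j=2}^{n-2}(j-1)e_jX_{P_{n-j,v}}+2(n+1)e_{n+1}+2(n-1)e_ne_1+2(n-3)e_{n-1}e_2,$$ with initial values $X_{P_{1,v}}=2e_2$, $X_{P_{2,v}}=6e_3$, and $X_{P_{3,v}}=8e_4+4e_3e_1$.
   Context: The chromatic symmetric function of a finite simple graph $H=(V,E)$ is $X_H=\sum_\kappa\prod_{u\in V}x_{\kappa(u)}$, the sum over all proper colorings $\kappa:V\to\mathbb{Z}_{>0}$. $P_n$ is the path on $n$ vertices. The twin of a graph at a vertex $v$ is obtained by adding a new vertex $v'$ joined to $v$ and to all neighbors of $v$. $P_{n,v}$ denotes $P_n$ twinned at an end vertex $v$ (for $n=1$, the only vertex). $e_i$ is the $i$-th elementary symmetric function; a symmetric function is $e$-positive if its expansion in the basis of elementary symmetric functions has nonnegative coefficients. -}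

module Defs where

open import Data.Bool using (if_then_else_)
open import Data.Empty using (⊥)
open import Data.Fin using (Fin; zero; suc; toℕ)
open import Data.Fin.Properties using (all?) renaming (_≟_ to _≟ᶠ_)
open import Data.Integer as ℤ using (ℤ; +_; 0ℤ; 1ℤ)
open import Data.List as List using (List; []; _∷_; allFin; cartesianProductWith; filter; foldr; length; upTo)
open import Data.List.Relation.Unary.All using (All)
open import Data.List.Relation.Unary.Linked using (Linked)
open import Data.List.Relation.Unary.Unique.Propositional using (Unique)
open import Data.Nat as ℕ using (ℕ; zero; suc; _∸_; _≥_; _>_; NonZero)
open import Data.Product using (Σ-syntax; _×_; _,_; proj₁; proj₂)
open import Data.Sum using (_⊎_; inj₁; inj₂; swap)
open import Data.Vec as Vec using (Vec; []; _∷_; lookup; tabulate; count)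
open import Data.Vec.Properties using (≡-dec)
import Data.Vec.Relation.Unary.All as VecAll
open import Relation.Binary.Definitions using (Decidable; Irreflexive; Symmetric)
open import Relation.Binary.PropositionalEquality using (_≡_; _≢_; refl)
open import Relation.Nullary using (Dec; no; ¬?)
open import Relation.Nullary.Decidable using (⌊_⌋; _×-dec_; _⊎-dec_; _→-dec_)

record Graph (n : ℕ) : Set₁ where
  infix 4 _~_ _~?_
  field
    _~_      : Fin n → Fin n → Set
    _~?_     : Decidable _~_
    ~-sym    : Symmetric _~_
    ~-irrefl : Irreflexive _≡_ _~_

degree : ∀ {n} → Graph n → Fin n → ℕ
degree G u = length (filter (u ~?_) (allFin _))
  where open Graph G

path : (n : ℕ) → Graph n
path n = record
  { _~_      = λ i j → suc (toℕ i) ≡ toℕ j ⊎ suc (toℕ j) ≡ toℕ i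
  ; _~?_     = λ i j → (suc (toℕ i) ℕ.≟ toℕ j) ⊎-dec (suc (toℕ j) ℕ.≟ toℕ i)
  ; ~-sym    = swap
  ; ~-irrefl = λ { refl (inj₁ p) → irr p ; refl (inj₂ p) → irr p }
  }
  where
  irr : ∀ {m} → suc m ≢ m
  irr ()

-- The new vertex v′ is zero; an old vertex u becomes suc u.
module _ {n : ℕ} (G : Graph n) (v : Fin n) where
  open Graph G

  TwinAdj : Fin (suc n) → Fin (suc n) → Set
  TwinAdj zero    zero    = ⊥
  TwinAdj zero    (suc j) = j ≡ v ⊎ v ~ j
  TwinAdj (suc i) zero    = i ≡ v ⊎ v ~ i
  TwinAdj (suc i) (suc j) = i ~ j

  private
    dec : Decidable TwinAdj
    dec zero    zero    = no λ ()
    dec zero    (suc j) = (j ≟ᶠ v) ⊎-dec (v ~? j)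
    dec (suc i) zero    = (i ≟ᶠ v) ⊎-dec (v ~? i)
    dec (suc i) (suc j) = i ~? j

    symm : Symmetric TwinAdj
    symm {zero}  {suc j} p = p
    symm {suc i} {zero}  p = p
    symm {suc i} {suc j} p = ~-sym p

    irrefl : Irreflexive _≡_ TwinAdj
    irrefl {suc i} refl p = ~-irrefl refl p

  twin : Graph (suc n)
  twin = record
    { _~_      = TwinAdj
    ; _~?_     = dec
    ; ~-sym    = λ {i} {j} → symm {i} {j}
    ; ~-irrefl = λ {i} {j} → irrefl {i} {j}
    }

-- Formal power series over ℤ in x₁, x₂, …, given by their coefficients: a
-- vector α : Vec ℕ N stands for the monomial x₁^α₁ ⋯ x_N^α_N.  Padding α with
-- zeros gives another name for the same monomial; every series built below
-- assigns the same coefficient to all names of a monomial.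

PowerSeries : Set
PowerSeries = (N : ℕ) → Vec ℕ N → ℤ

infix  4 _≈_
infixl 6 _⊕_
infixl 7 _⊗_
infixr 8 _⊙_

_≈_ : PowerSeries → PowerSeries → Set
F ≈ G = ∀ N (α : Vec ℕ N) → F N α ≡ G N α

𝟘 : PowerSeries
𝟘 N α = 0ℤ

𝟙 : PowerSeries
𝟙 N α = if ⌊ VecAll.all? (ℕ._≟ 0) α ⌋ then 1ℤ else 0ℤ

_⊕_ : PowerSeries → PowerSeries → PowerSeries
(F ⊕ G) N α = F N α ℤ.+ G N α

_⊙_ : ℤ → PowerSeries → PowerSeries
(c ⊙ F) N α = c ℤ.* F N α

-- All (β , γ) with β + γ = α componentwise.
splits : ∀ {N} → Vec ℕ N → List (Vec ℕ N × Vec ℕ N)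
splits []      = ([] , []) ∷ []
splits (a ∷ α) =
  cartesianProductWith (λ { k (β , γ) → (k ∷ β , (a ∸ k) ∷ γ) }) (upTo (suc a)) (splits α)

_⊗_ : PowerSeries → PowerSeries → PowerSeries
(F ⊗ G) N α = foldr ℤ._+_ 0ℤ (List.map (λ { (β , γ) → F N β ℤ.* G N γ }) (splits α))

∑-range : ℕ → ℕ → (ℕ → PowerSeries) → PowerSeries
∑-range a b F N α = foldr ℤ._+_ 0ℤ (List.map (λ i → F (a ℕ.+ i) N α) (upTo (suc b ∸ a)))

infix 5 ∑-range
syntax ∑-range a b (λ j → F) = ∑[ j from a to b ] F

e : ℕ → PowerSeries
e k N α =
  if ⌊ VecAll.all? (ℕ._≤? 1) α ×-dec (Vec.sum α ℕ.≟ k) ⌋ then 1ℤ else 0ℤ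

e-product : List ℕ → PowerSeries
e-product []       = 𝟙
e-product (k ∷ ks) = e k ⊗ e-product ks

IsPartition : List ℕ → Set
IsPartition μ = Linked _≥_ μ × All (_> 0) μ

e-combination : List (ℤ × List ℕ) → PowerSeries
e-combination []             = 𝟘
e-combination ((c , μ) ∷ ts) = c ⊙ e-product μ ⊕ e-combination ts

record EExpansion (F : PowerSeries) : Set where
  field
    terms      : List (ℤ × List ℕ)
    partitions : All IsPartition (List.map proj₂ terms)
    distinct   : Unique (List.map proj₂ terms)
    expansion  : F ≈ e-combination terms

EPositive : PowerSeries → Set
EPositive F =
  Σ[ E ∈ EExpansion F ] All (ℤ._≤_ 0ℤ) (List.map proj₁ (EExpansion.terms E))

-- A coloring by positive integers whose monomial is x₁^α₁ ⋯ x_N^α_N only uses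
-- the colors 1, …, N, so the coefficient of that monomial in X G counts
-- colorings with colors in Fin N.

colorings : (N n : ℕ) → List (Vec (Fin N) n)
colorings N zero    = [] ∷ []
colorings N (suc n) = cartesianProductWith _∷_ (allFin N) (colorings N n)

content : ∀ {N n} → Vec (Fin N) n → Vec ℕ N
content κ = tabulate λ i → count (i ≟ᶠ_) κ

module _ {n : ℕ} (G : Graph n) where
  open Graph G

  Proper : ∀ {N} → Vec (Fin N) n → Set
  Proper κ = ∀ i j → i ~ j → lookup κ i ≢ lookup κ j

  proper? : ∀ {N} (κ : Vec (Fin N) n) → Dec (Proper κ)
  proper? κ = all? λ i → all? λ j → (i ~? j) →-dec ¬? (lookup κ i ≟ᶠ lookup κ j)

  X : PowerSeries
  X N α =
    + length (filter (λ κ → proper? κ ×-dec ≡-dec ℕ._≟_ (content κ) α) (colorings N n))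

IsEndVertex : (n : ℕ) → Fin n → Set
IsEndVertex n v = n ≡ 1 ⊎ degree (path n) v ≡ 1

-- A choice of an end vertex v in every nonempty path, as needed to speak of
-- P_{n,v} and P_{n-j,v} in one formula.
record EndVertices : Set where
  field
    vertex : (n : ℕ) → .{{NonZero n}} → Fin n
    isEnd  : (n : ℕ) → .{{_ : NonZero n}} → IsEndVertex n (vertex n)

-- X of P_{n,v}.  There is no P_{0,v}; the value at n = 0 is a dummy.
XPᵥ : EndVertices → ℕ → PowerSeries
XPᵥ v zero      = 𝟘
XPᵥ v n@(suc _) = X (twin (path n) (EndVertices.vertex v n))

XP : ℕ → PowerSeries
XP n = X (path n)

{-# OPTIONS --safe #-}
module Submission where

-- A proper coloring of a path is a word without equal adjacent letters.  If W_i
-- is the generating function in z of the words starting with the letter i, and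
-- 𝕏 that of all words, then 𝕏 = 1 + ∑ W_i and (1 + x_i z) W_i = x_i z 𝕏.  The
-- generating function F_i of the monomials of E = ∑ e_k z^k divisible by x_i
-- satisfies (1 + x_i z) F_i = x_i z E and ∑ F_i = z E′.  Hence E W_i = F_i 𝕏, so
-- E 𝕏 = E + z E′ 𝕏, which says X(P_n) = e_n + ∑_{j ≥ 2} (j - 1) e_j X(P_{n-j}).
-- Triple deletion in the triangle of the twinned path gives
-- X(P_{n,v}) = 2 X(P_{n+1}) - X(P_2) X(P_{n-1}) with X(P_2) = 2 e_2, and all
-- formulas follow by substituting the recurrence for paths.

open import Algebra.Bundles using (CommutativeRing)
open import Algebra.Core using (Op₂)
import Algebra.Morphism.RingMonomorphism as RingMonomorphism
open import Algebra.Morphism.Structures using (IsRingMonomorphism)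
import Algebra.Properties.Semiring.Mult as Mult
import Algebra.Solver.Ring.NaturalCoefficients.Default as RingSolver
open import Algebra.Structures using (IsCommutativeRing)
open import Data.Bool using (Bool; true; false; _∧_; not; if_then_else_; T)
open import Data.Bool.Properties using (T-∧; ∧-zeroʳ)
open import Data.Empty using (⊥-elim)
open import Data.Fin using (Fin; zero; suc; toℕ; opposite; inject₁; fromℕ; fromℕ<)
open import Data.Fin.Properties using (opposite-prop; opposite-involutive; toℕ<n; toℕ-fromℕ<; toℕ-inject₁; toℕ-injective) renaming (_≟_ to _≟ᶠ_)
open import Data.Integer as ℤ using (ℤ; 0ℤ; 1ℤ)
import Data.Integer.Properties as ℤ
open import Data.Integer.Solver using (module +-*-Solver)
open import Data.List as List using (List; []; _∷_; _++_; allFin; cartesianProductWith; filter; foldr; length; map; upTo)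
open import Data.List.Membership.Propositional using (_∈_)
open import Data.List.Membership.Propositional.Properties using (∈-filter⁺; ∈-allFin)
import Data.List.Properties as List
open import Data.List.Relation.Binary.Permutation.Propositional using (_↭_; ↭-sym)
open import Data.List.Relation.Binary.Permutation.Propositional.Properties using (All-resp-↭)
open import Data.List.Relation.Unary.All as All using (All; []; _∷_)
import Data.List.Relation.Unary.All.Properties as All
open import Data.List.Relation.Unary.AllPairs using ([]; _∷_)
open import Data.List.Relation.Unary.Any using (here)
open import Data.List.Relation.Unary.Unique.Propositional using (Unique)
import Data.List.Sort as Sort
open import Data.Nat as ℕ using (ℕ; zero; suc; _∸_; _>_)
import Data.Nat.Properties as ℕ
open import Data.Product using (_×_; _,_; proj₁; proj₂; Σ-syntax)
open import Data.Sum as Sum using (_⊎_; inj₁; inj₂)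
open import Data.Unit using (tt)
open import Data.Vec as Vec using (Vec; []; _∷_; _∷ʳ_; lookup; reverse; tabulate; updateAt)
open import Data.Vec.Properties using (reverse-∷; reverse-involutive)
import Data.Vec.Properties as Vec
import Data.Vec.Relation.Unary.All as VecAll
open import Function using (_∘_; Equivalence)
open import Function.Bundles using (mk⇔)
open import Level using (0ℓ)
import Relation.Binary.Construct.Flip.EqAndOrd as Flip
import Relation.Binary.PropositionalEquality as ≡
import Relation.Binary.Reasoning.Setoid as SetoidReasoning
open import Relation.Nullary using (Dec; does; yes; no; ¬_)
open import Relation.Nullary.Decidable using (_×-dec_; isYes≗does; does-⇔; dec-true; dec-false)
open import Defs using (colorings)

-- The indeterminate z is kept apart from the variables x_i: generating functions are univariate
-- series over the ring of series in x_1, ..., x_N for a fixed N, so the coefficient of z^n isolates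
-- the path on n vertices. Division by 1 + x_i z is replaced by cancellation, and the identities for
-- words avoid subtraction, so that a solver for commutative semirings applies. Positivity rests on
-- how terms cancel. In 2 X(P_{n+1}) the summand j = 2 is 2 e_2 X(P_{n-1}), exactly what triple
-- deletion subtracts. For the recurrence, the deletion relation is used for P_{n,v} and for every
-- P_{n-j,v} in the sum; the summands j = n - 1 and j = n of X(P_{n+1}) are 2 (n - 2) e_{n-1} e_2
-- and (n - 1) e_n e_1. Twice the former, minus the 2 (n - 1) e_{n-1} e_2 hidden in 2 e_2
-- X(P_{n-1}), gives the coefficient 2 (n - 3). Stopping the sum at j = n - 2 is what preserves
-- positivity: taking in X(P_{1,v}) = 2 e_2 at j = n - 1 would leave -2 e_{n-1} e_2.

convolve : {A : Set} → Op₂ A → Op₂ A → Op₂ (ℕ → A)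
convolve _+_ _*_ f g zero    = f 0 * g 0
convolve _+_ _*_ f g (suc n) = (f 0 * g (suc n)) + convolve _+_ _*_ (f ∘ suc) g n

-- Univariate formal power series

module Series (R : CommutativeRing 0ℓ 0ℓ) where
  open CommutativeRing R hiding (zero)
  open SetoidReasoning setoid
  module Solver = RingSolver commutativeSemiring
  open Solver using (solve; _:+_; _:*_; _:=_)

  infixl 7 _✶_
  _✶_ : (ℕ → Carrier) → (ℕ → Carrier) → ℕ → Carrier
  _✶_ = convolve _+_ _*_

  infix 4 _≋_
  _≋_ : (ℕ → Carrier) → (ℕ → Carrier) → Set
  f ≋ g = ∀ n → f n ≈ g n

  infixl 6 _⊞_
  _⊞_ : (ℕ → Carrier) → (ℕ → Carrier) → ℕ → Carrier
  (f ⊞ g) n = f n + g n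

  constant : Carrier → ℕ → Carrier
  constant a zero    = a
  constant a (suc _) = 0#

  ✶-cong : ∀ {f f′ g g′} → f ≋ f′ → g ≋ g′ → f ✶ g ≋ f′ ✶ g′
  ✶-cong p q zero    = *-cong (p 0) (q 0)
  ✶-cong p q (suc n) = +-cong (*-cong (p 0) (q (suc n))) (✶-cong (p ∘ suc) q n)

  0✶ : ∀ f n → ((λ _ → 0#) ✶ f) n ≈ 0#
  0✶ f zero    = zeroˡ _
  0✶ f (suc n) = trans (+-cong (zeroˡ _) (0✶ f n)) (+-identityˡ 0#)

  scale-✶ : ∀ a f g n → ((λ k → a * f k) ✶ g) n ≈ a * (f ✶ g) n
  scale-✶ a f g zero    = *-assoc a _ _
  scale-✶ a f g (suc n) = begin
    a * f 0 * g (suc n) + ((λ k → a * f (suc k)) ✶ g) n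
      ≈⟨ +-cong (*-assoc a _ _) (scale-✶ a (f ∘ suc) g n) ⟩
    a * (f 0 * g (suc n)) + a * ((f ∘ suc) ✶ g) n
      ≈⟨ distribˡ a _ _ ⟨
    a * (f ✶ g) (suc n) ∎

  ✶-distribʳ : ∀ f g h → (g ⊞ h) ✶ f ≋ g ✶ f ⊞ h ✶ f
  ✶-distribʳ f g h zero    = distribʳ _ _ _
  ✶-distribʳ f g h (suc n) = begin
    (g 0 + h 0) * f (suc n) + ((g ∘ suc ⊞ h ∘ suc) ✶ f) n
      ≈⟨ +-congˡ (✶-distribʳ f (g ∘ suc) (h ∘ suc) n) ⟩
    (g 0 + h 0) * f (suc n) + (((g ∘ suc) ✶ f) n + ((h ∘ suc) ✶ f) n)
      ≈⟨ solve 5 (λ a b c d e → (a :+ b) :* c :+ (d :+ e) := (a :* c :+ d) :+ (b :* c :+ e))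
           refl _ _ _ _ _ ⟩
    (g ✶ f) (suc n) + (h ✶ f) (suc n) ∎

  -- Peels off the summand with `g 0`, whereas `convolve` peels off the one with `f 0`;
  -- commutativity needs both.
  ✶-sucʳ : ∀ f g n → (f ✶ g) (suc n) ≈ (f ✶ (g ∘ suc)) n + f (suc n) * g 0
  ✶-sucʳ f g zero    = refl
  ✶-sucʳ f g (suc n) = begin
    f 0 * g (suc (suc n)) + ((f ∘ suc) ✶ g) (suc n)
      ≈⟨ +-congˡ (✶-sucʳ (f ∘ suc) g n) ⟩
    f 0 * g (suc (suc n)) + (((f ∘ suc) ✶ (g ∘ suc)) n + f (suc (suc n)) * g 0)
      ≈⟨ +-assoc _ _ _ ⟨
    (f ✶ (g ∘ suc)) (suc n) + f (suc (suc n)) * g 0 ∎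

  ✶-comm : ∀ f g → f ✶ g ≋ g ✶ f
  ✶-comm f g zero    = *-comm _ _
  ✶-comm f g (suc n) = begin
    f 0 * g (suc n) + ((f ∘ suc) ✶ g) n ≈⟨ +-cong (*-comm _ _) (✶-comm (f ∘ suc) g n) ⟩
    g (suc n) * f 0 + (g ✶ (f ∘ suc)) n ≈⟨ +-comm _ _ ⟩
    (g ✶ (f ∘ suc)) n + g (suc n) * f 0 ≈⟨ ✶-sucʳ g f n ⟨
    (g ✶ f) (suc n) ∎

  ✶-assoc : ∀ f g h → (f ✶ g) ✶ h ≋ f ✶ (g ✶ h)
  ✶-assoc f g h zero    = *-assoc _ _ _
  ✶-assoc f g h (suc n) = begin
    f 0 * g 0 * h (suc n) + (((λ k → f 0 * g (suc k)) ⊞ (f ∘ suc) ✶ g) ✶ h) n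
      ≈⟨ +-cong (*-assoc _ _ _) (✶-distribʳ h _ _ n) ⟩
    f 0 * (g 0 * h (suc n)) + (((λ k → f 0 * g (suc k)) ✶ h) n + (((f ∘ suc) ✶ g) ✶ h) n)
      ≈⟨ +-congˡ (+-cong (scale-✶ (f 0) (g ∘ suc) h n) (✶-assoc (f ∘ suc) g h n)) ⟩
    f 0 * (g 0 * h (suc n)) + (f 0 * ((g ∘ suc) ✶ h) n + ((f ∘ suc) ✶ (g ✶ h)) n)
      ≈⟨ solve 4 (λ a b c d → a :* b :+ (a :* c :+ d) := a :* (b :+ c) :+ d) refl _ _ _ _ ⟩
    f 0 * (g ✶ h) (suc n) + ((f ∘ suc) ✶ (g ✶ h)) n ∎

  constant-✶ : ∀ a f n → (constant a ✶ f) n ≈ a * f n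
  constant-✶ a f zero    = refl
  constant-✶ a f (suc n) = trans (+-congˡ (0✶ f n)) (+-identityʳ _)

  ✶-identityˡ : ∀ f → constant 1# ✶ f ≋ f
  ✶-identityˡ f n = trans (constant-✶ 1# f n) (*-identityˡ _)

  seriesRing : CommutativeRing 0ℓ 0ℓ
  seriesRing = record
    { Carrier = ℕ → Carrier
    ; _≈_ = _≋_
    ; _+_ = _⊞_
    ; _*_ = _✶_
    ; -_  = λ f n → - f n
    ; 0#  = λ _ → 0#
    ; 1#  = constant 1#
    ; isCommutativeRing = record
      { isRing = record
        { +-isAbelianGroup = record
          { isGroup = record
            { isMonoid = record
              { isSemigroup = record
                { isMagma = record
                  { isEquivalence = record
                    { refl  = λ _ → refl
                    ; sym   = λ p n → sym (p n)
                    ; trans = λ p q n → trans (p n) (q n)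
                    }
                  ; ∙-cong = λ p q n → +-cong (p n) (q n)
                  }
                ; assoc = λ f g h n → +-assoc _ _ _
                }
              ; identity = (λ f n → +-identityˡ _) , (λ f n → +-identityʳ _)
              }
            ; inverse = (λ f n → -‿inverseˡ _) , (λ f n → -‿inverseʳ _)
            ; ⁻¹-cong = λ p n → -‿cong (p n)
            }
          ; comm = λ f g n → +-comm _ _
          }
        ; *-cong = ✶-cong
        ; *-assoc = ✶-assoc
        ; *-identity = ✶-identityˡ , λ f n → trans (✶-comm f _ n) (✶-identityˡ f n)
        ; distrib = (λ f g h n → trans (✶-comm f _ n) (trans (✶-distribʳ f g h n)
                      (+-cong (✶-comm g f n) (✶-comm h f n))))
                  , ✶-distribʳ
        }
      ; *-comm = ✶-comm
      }
    }

  shift : (ℕ → Carrier) → ℕ → Carrier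
  shift f zero    = 0#
  shift f (suc n) = f n

  shift-✶ : ∀ f g → shift f ✶ g ≋ shift (f ✶ g)
  shift-✶ f g zero    = zeroˡ _
  shift-✶ f g (suc n) = trans (+-congʳ (zeroˡ _)) (+-identityˡ _)

-- Finite sums

module Sums (R : CommutativeRing 0ℓ 0ℓ) where
  open CommutativeRing R hiding (zero)
  open SetoidReasoning setoid
  open Series R using (_✶_; module Solver)
  open Solver using (solve; _:+_; _:*_; _:=_)

  ∑ : {I : Set} → List I → (I → Carrier) → Carrier
  ∑ []       f = 0#
  ∑ (i ∷ is) f = f i + ∑ is f

  ∑-cong : {I : Set} (is : List I) {f g : I → Carrier} → (∀ i → f i ≈ g i) → ∑ is f ≈ ∑ is g
  ∑-cong []       p = refl
  ∑-cong (i ∷ is) p = +-cong (p i) (∑-cong is p)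

  ∑-0 : {I : Set} (is : List I) → ∑ is (λ _ → 0#) ≈ 0#
  ∑-0 []       = refl
  ∑-0 (i ∷ is) = trans (+-identityˡ _) (∑-0 is)

  ∑-+ : {I : Set} (is : List I) (f g : I → Carrier) → ∑ is (λ i → f i + g i) ≈ ∑ is f + ∑ is g
  ∑-+ []       f g = sym (+-identityˡ 0#)
  ∑-+ (i ∷ is) f g = trans (+-congˡ (∑-+ is f g))
    (solve 4 (λ a b c d → (a :+ b) :+ (c :+ d) := (a :+ c) :+ (b :+ d)) refl _ _ _ _)

  *-∑ : {I : Set} (is : List I) (a : Carrier) (f : I → Carrier) → ∑ is (λ i → a * f i) ≈ a * ∑ is f
  *-∑ []       a f = sym (zeroʳ a)
  *-∑ (i ∷ is) a f = trans (+-congˡ (*-∑ is a f)) (sym (distribˡ a _ _))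

  ∑-* : {I : Set} (is : List I) (a : Carrier) (f : I → Carrier) → ∑ is (λ i → f i * a) ≈ ∑ is f * a
  ∑-* is a f = trans (∑-cong is (λ i → *-comm _ _)) (trans (*-∑ is a f) (*-comm _ _))

  ∑-swap : {I J : Set} (is : List I) (js : List J) (f : I → J → Carrier) →
           ∑ is (λ i → ∑ js (f i)) ≈ ∑ js (λ j → ∑ is (λ i → f i j))
  ∑-swap []       js f = sym (∑-0 js)
  ∑-swap (i ∷ is) js f = trans (+-congˡ (∑-swap is js f)) (sym (∑-+ js (f i) _))

  ∑-++ : {I : Set} (is js : List I) (f : I → Carrier) → ∑ (is ++ js) f ≈ ∑ is f + ∑ js f
  ∑-++ []       js f = sym (+-identityˡ _)
  ∑-++ (i ∷ is) js f = trans (+-congˡ (∑-++ is js f)) (sym (+-assoc _ _ _))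

  ∑-map : {I J : Set} (h : I → J) (is : List I) (f : J → Carrier) → ∑ (map h is) f ≡.≡ ∑ is (f ∘ h)
  ∑-map h []       f = ≡.refl
  ∑-map h (i ∷ is) f = ≡.cong (f (h i) +_) (∑-map h is f)

  ∑-cartesianProductWith : {I J K : Set} (h : I → J → K) (is : List I) (js : List J) (f : K → Carrier) →
    ∑ (cartesianProductWith h is js) f ≈ ∑ is (λ i → ∑ js (λ j → f (h i j)))
  ∑-cartesianProductWith h []       js f = refl
  ∑-cartesianProductWith h (i ∷ is) js f = begin
    ∑ (map (h i) js ++ cartesianProductWith h is js) f
      ≈⟨ ∑-++ (map (h i) js) _ f ⟩
    ∑ (map (h i) js) f + ∑ (cartesianProductWith h is js) f
      ≈⟨ +-cong (reflexive (∑-map (h i) js f)) (∑-cartesianProductWith h is js f) ⟩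
    ∑ js (λ j → f (h i j)) + ∑ is (λ i → ∑ js (λ j → f (h i j))) ∎

  ∑-upTo-suc : ∀ n (f : ℕ → Carrier) → ∑ (upTo (suc n)) f ≡.≡ f 0 + ∑ (upTo n) (f ∘ suc)
  ∑-upTo-suc n f = ≡.cong (f 0 +_)
    (≡.trans (≡.cong (λ is → ∑ is f) (≡.sym (List.map-upTo suc n))) (∑-map suc (upTo n) f))

  ∑-upTo-last : ∀ n (f : ℕ → Carrier) → ∑ (upTo (suc n)) f ≈ ∑ (upTo n) f + f n
  ∑-upTo-last n f = begin
    ∑ (upTo (suc n)) f              ≡⟨ ≡.cong (λ is → ∑ is f) (List.upTo-∷ʳ n) ⟨
    ∑ (upTo n ++ n ∷ []) f          ≈⟨ ∑-++ (upTo n) _ f ⟩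
    ∑ (upTo n) f + (f n + 0#)       ≈⟨ +-congˡ (+-identityʳ _) ⟩
    ∑ (upTo n) f + f n              ∎

  ∑-upTo-cong : ∀ n {f g : ℕ → Carrier} → (∀ i → i ℕ.< n → f i ≈ g i) → ∑ (upTo n) f ≈ ∑ (upTo n) g
  ∑-upTo-cong zero    p = refl
  ∑-upTo-cong (suc n) {f} {g} p = begin
    ∑ (upTo (suc n)) f        ≡⟨ ∑-upTo-suc n f ⟩
    f 0 + ∑ (upTo n) (f ∘ suc) ≈⟨ +-cong (p 0 (ℕ.s≤s ℕ.z≤n)) (∑-upTo-cong n (λ i q → p (suc i) (ℕ.s≤s q))) ⟩
    g 0 + ∑ (upTo n) (g ∘ suc) ≡⟨ ∑-upTo-suc n g ⟨
    ∑ (upTo (suc n)) g        ∎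

  ✶-as-∑ : ∀ f g n → (f ✶ g) n ≈ ∑ (upTo (suc n)) (λ i → f i * g (n ∸ i))
  ✶-as-∑ f g zero    = sym (+-identityʳ _)
  ✶-as-∑ f g (suc n) = begin
    f 0 * g (suc n) + ((f ∘ suc) ✶ g) n
      ≈⟨ +-congˡ (✶-as-∑ (f ∘ suc) g n) ⟩
    f 0 * g (suc n) + ∑ (upTo (suc n)) (λ i → f (suc i) * g (n ∸ i))
      ≡⟨ ∑-upTo-suc (suc n) (λ i → f i * g (suc n ∸ i)) ⟨
    ∑ (upTo (suc (suc n))) (λ i → f i * g (suc n ∸ i)) ∎

  ∑-allFin-suc : ∀ {M} (g : Fin (suc M) → Carrier) → ∑ (allFin (suc M)) g ≡.≡ g zero + ∑ (allFin M) (g ∘ suc)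
  ∑-allFin-suc {M} g = ≡.cong (g zero +_)
    (≡.trans (≡.cong (λ is → ∑ is g) (≡.sym (List.map-tabulate (λ i → i) suc))) (∑-map suc (allFin M) g))

-- The transfer recursion for words without equal adjacent letters

module Transfer (R : CommutativeRing 0ℓ 0ℓ) where
  open CommutativeRing R hiding (zero)
  open Series R
  open Sums R
  open import Algebra.Properties.Ring (CommutativeRing.ring R) using (+-cancelˡ; +-cancelʳ)
  open import Algebra.Properties.Monoid.Mult +-monoid using () renaming (_×_ to _·_)
  private
    module S = CommutativeRing seriesRing

  -- 1 + a z is not a zero divisor.
  cancel-1+az : ∀ a f g → f ⊞ shift (λ n → a * f n) ≋ g ⊞ shift (λ n → a * g n) → f ≋ g
  cancel-1+az a f g p zero    = +-cancelʳ _ _ _ (p 0)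
  cancel-1+az a f g p (suc n) =
    +-cancelʳ _ _ _ (trans (p (suc n)) (+-congˡ (*-congˡ (sym (cancel-1+az a f g p n)))))

  shift-cong : ∀ {f g} → f ≋ g → shift f ≋ shift g
  shift-cong p zero    = refl
  shift-cong p (suc n) = p n

  ∑-✶ : {I : Set} (is : List I) (f : I → ℕ → Carrier) (g : ℕ → Carrier) →
        ∀ n → ∑ is (λ i → (f i ✶ g) n) ≈ ((λ k → ∑ is (λ i → f i k)) ✶ g) n
  ∑-✶ []       f g n = sym (0✶ g n)
  ∑-✶ (i ∷ is) f g n = trans (+-congˡ (∑-✶ is f g n)) (sym (✶-distribʳ g (f i) _ n))

  -- Words and monomials enter only through these recursions: the hypotheses on `W` and on `f` are
  -- the two equations with the factor 1 + x_i z, read coefficient by coefficient, and `n · e n` is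
  -- the coefficient of z E′.
  module _ {I : Set} (is : List I) (x : I → Carrier)
    (X e : ℕ → Carrier) (W f : I → ℕ → Carrier)
    (X-zero : X 0 ≈ 1#)
    (e-zero : e 0 ≈ 1#)
    (X-suc : ∀ n → X (suc n) ≈ ∑ is (λ i → W i (suc n)))
    (W-zero : ∀ i → W i 0 ≈ 0#)
    (W-suc : ∀ i n → W i (suc n) + x i * W i n ≈ x i * X n)
    (f-zero : ∀ i → f i 0 ≈ 0#)
    (f-suc : ∀ i n → f i (suc n) + x i * f i n ≈ x i * e n)
    (∑-f : ∀ n → ∑ is (λ i → f i n) ≈ n · e n)
    where

    private
      xz : I → (ℕ → Carrier) → ℕ → Carrier
      xz i g = shift (λ n → x i * g n)

      xz-✶ : ∀ i g h → xz i g ✶ h ≋ xz i (g ✶ h)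
      xz-✶ i g h = S.trans (shift-✶ _ h) (shift-cong (scale-✶ (x i) g h))

      -- Both sides become x_i z e X after multiplication by 1 + x_i z, which can be cancelled.
      eW≋fX : ∀ i → W i ✶ e ≋ f i ✶ X
      eW≋fX i = cancel-1+az (x i) _ _ (begin
        W i ✶ e ⊞ xz i (W i ✶ e)   ≈⟨ S.+-congˡ (xz-✶ i (W i) e) ⟨
        W i ✶ e ⊞ xz i (W i) ✶ e   ≈⟨ ✶-distribʳ e (W i) (xz i (W i)) ⟨
        (W i ⊞ xz i (W i)) ✶ e     ≈⟨ ✶-cong {g = e} recW (λ _ → refl) ⟩
        xz i X ✶ e                 ≈⟨ xz-✶ i X e ⟩
        xz i (X ✶ e)               ≈⟨ shift-cong (λ n → *-congˡ (✶-comm X e n)) ⟩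
        xz i (e ✶ X)               ≈⟨ xz-✶ i e X ⟨
        xz i e ✶ X                 ≈⟨ ✶-cong {g = X} recf (λ _ → refl) ⟨
        (f i ⊞ xz i (f i)) ✶ X     ≈⟨ ✶-distribʳ X (f i) (xz i (f i)) ⟩
        f i ✶ X ⊞ xz i (f i) ✶ X   ≈⟨ S.+-congˡ (xz-✶ i (f i) X) ⟩
        f i ✶ X ⊞ xz i (f i ✶ X)   ∎)
        where
        open SetoidReasoning S.setoid
        recW : W i ⊞ xz i (W i) ≋ xz i X
        recW zero    = trans (+-identityʳ _) (W-zero i)
        recW (suc n) = W-suc i n
        recf : f i ⊞ xz i (f i) ≋ xz i e
        recf zero    = trans (+-identityʳ _) (f-zero i)
        recf (suc n) = f-suc i n

      X≋1+W : X ≋ constant 1# ⊞ (λ n → ∑ is (λ i → W i n))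
      X≋1+W zero    = trans X-zero (sym (trans (+-congˡ (trans (∑-cong is W-zero) (∑-0 is))) (+-identityʳ _)))
      X≋1+W (suc n) = trans (X-suc n) (sym (+-identityˡ _))

    transfer : ∀ n → (e ✶ X) n ≈ e n + ((λ k → k · e k) ✶ X) n
    transfer = begin
      e ✶ X                                         ≈⟨ ✶-comm e X ⟩
      X ✶ e                                         ≈⟨ ✶-cong {g = e} X≋1+W (λ _ → refl) ⟩
      (constant 1# ⊞ (λ n → ∑ is (λ i → W i n))) ✶ e ≈⟨ ✶-distribʳ e _ _ ⟩
      constant 1# ✶ e ⊞ (λ n → ∑ is (λ i → W i n)) ✶ e
        ≈⟨ S.+-cong (✶-identityˡ e) (λ n → sym (∑-✶ is W e n)) ⟩
      e ⊞ (λ n → ∑ is (λ i → (W i ✶ e) n))          ≈⟨ S.+-congˡ (λ n → ∑-cong is (λ i → eW≋fX i n)) ⟩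
      e ⊞ (λ n → ∑ is (λ i → (f i ✶ X) n))          ≈⟨ S.+-congˡ (∑-✶ is f X) ⟩
      e ⊞ (λ n → ∑ is (λ i → f i n)) ✶ X            ≈⟨ S.+-congˡ (✶-cong {g = X} ∑-f (λ _ → refl)) ⟩
      e ⊞ (λ k → k · e k) ✶ X                       ∎
      where open SetoidReasoning S.setoid

    -- Subtracting (e - 1) X from `transfer` would give the coefficients k - 1, with an exception at
    -- k = 0. The identity K + 1 = e + M expresses this additively: at 0 truncated subtraction makes
    -- `M 0` vanish, and the unit series accounts for `e 0`.
    chromatic-recurrence : X ≋ e ⊞ (λ k → (k ∸ 1) · e k) ✶ X
    chromatic-recurrence n = +-cancelˡ _ _ _ (begin
      (K ✶ X) n + X n                       ≈⟨ +-congˡ (✶-identityˡ X n) ⟨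
      (K ✶ X) n + (constant 1# ✶ X) n       ≈⟨ ✶-distribʳ X K (constant 1#) n ⟨
      ((K ⊞ constant 1#) ✶ X) n             ≈⟨ ✶-cong {g = X} split (λ _ → refl) n ⟩
      ((e ⊞ M) ✶ X) n                       ≈⟨ ✶-distribʳ X e M n ⟩
      (e ✶ X) n + (M ✶ X) n                 ≈⟨ +-congʳ (transfer n) ⟩
      (e n + (K ✶ X) n) + (M ✶ X) n         ≈⟨ Solver.solve 3 (λ a b c → (a Solver.:+ b) Solver.:+ c Solver.:= b Solver.:+ (a Solver.:+ c)) refl _ _ _ ⟩
      (K ✶ X) n + (e n + (M ✶ X) n)         ∎)
      where
      open SetoidReasoning setoid
      K M : ℕ → Carrier
      K k = k · e k
      M k = (k ∸ 1) · e k
      split : K ⊞ constant 1# ≋ e ⊞ M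
      split zero    = trans (+-comm _ _) (+-congʳ (sym e-zero))
      split (suc k) = +-identityʳ _

-- Colorings as words

module _ {N : ℕ} where

  differ : Fin N → Fin N → Bool
  differ a b = not (does (a ≟ᶠ b))

  extends : ∀ {n} → Fin N → Vec (Fin N) n → Bool
  extends a []      = true
  extends a (b ∷ κ) = differ a b

  isPathColoring : ∀ {n} → Vec (Fin N) n → Bool
  isPathColoring []      = true
  isPathColoring (a ∷ κ) = extends a κ ∧ isPathColoring κ

  -- The letter `a` colors the new vertex and `b` the twinned end vertex. Both see the first letter
  -- of `κ`; for `b` this is tested within `isPathColoring`.
  isTwinColoring : ∀ {n} → Fin N → Vec (Fin N) (suc n) → Bool
  isTwinColoring a (b ∷ κ) = (differ a b ∧ extends a κ) ∧ isPathColoring (b ∷ κ)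

module Words (R : CommutativeRing 0ℓ 0ℓ) (N : ℕ) (x : Fin N → CommutativeRing.Carrier R) where
  open CommutativeRing R hiding (zero)
  open SetoidReasoning setoid
  open Series R using (module Solver)
  open Solver using (solve; _:+_; _:*_; _:=_; con)
  open Sums R

  -- Iverson brackets turn conditions on colors into ring elements, so that case distinctions become
  -- polynomial identities.
  ⟦_⟧ : Bool → Carrier
  ⟦ true  ⟧ = 1#
  ⟦ false ⟧ = 0#

  ⟦⟧-∧ : ∀ p q → ⟦ p ∧ q ⟧ ≈ ⟦ p ⟧ * ⟦ q ⟧
  ⟦⟧-∧ true  q = sym (*-identityˡ _)
  ⟦⟧-∧ false q = sym (zeroˡ _)

  ⟦⟧-not : ∀ p → ⟦ not p ⟧ + ⟦ p ⟧ ≈ 1#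
  ⟦⟧-not true  = +-identityˡ _
  ⟦⟧-not false = +-identityʳ _

  monomial : ∀ {n} → Vec (Fin N) n → Carrier
  monomial []      = 1#
  monomial (a ∷ κ) = x a * monomial κ

  weight : ∀ {n} → Vec (Fin N) n → Carrier
  weight κ = ⟦ isPathColoring κ ⟧ * monomial κ

  pathSum : ℕ → Carrier
  pathSum n = ∑ (colorings N n) weight

  -- No word of length 0 has a first letter, and the value 0 there makes `pathSumFrom-suc` hold from
  -- n = 0 on.
  pathSumFrom : Fin N → ℕ → Carrier
  pathSumFrom a zero    = 0#
  pathSumFrom a (suc n) = ∑ (colorings N n) (λ κ → weight (a ∷ κ))

  twinSum : ℕ → Carrier
  twinSum n = ∑ (allFin N) (λ a → ∑ (colorings N (suc n)) (λ κ → ⟦ isTwinColoring a κ ⟧ * monomial (a ∷ κ)))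

  ∑-colorings : ∀ n (g : Vec (Fin N) (suc n) → Carrier) →
    ∑ (colorings N (suc n)) g ≈ ∑ (allFin N) (λ a → ∑ (colorings N n) (λ κ → g (a ∷ κ)))
  ∑-colorings n g = ∑-cartesianProductWith _∷_ (allFin N) (colorings N n) g

  weight-∷ : ∀ {n} a (κ : Vec (Fin N) n) → weight (a ∷ κ) ≈ ⟦ extends a κ ⟧ * (x a * weight κ)
  weight-∷ a κ = trans (*-congʳ (⟦⟧-∧ (extends a κ) _))
    (solve 4 (λ p q y z → (p :* q) :* (y :* z) := p :* (y :* (q :* z))) refl _ _ _ _)

  pathSum-zero : pathSum 0 ≈ 1#
  pathSum-zero = trans (+-identityʳ _) (*-identityˡ _)

  pathSum-suc : ∀ n → pathSum (suc n) ≈ ∑ (allFin N) (λ a → pathSumFrom a (suc n))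
  pathSum-suc n = ∑-colorings n weight

  ∑-Kronecker : ∀ {M} (i : Fin M) (g : Fin M → Carrier) → ∑ (allFin M) (λ j → ⟦ does (i ≟ᶠ j) ⟧ * g j) ≈ g i
  ∑-Kronecker {suc M} zero g = begin
    ∑ (allFin (suc M)) (λ j → ⟦ does (zero ≟ᶠ j) ⟧ * g j) ≡⟨ ∑-allFin-suc (λ j → ⟦ does (zero ≟ᶠ j) ⟧ * g j) ⟩
    1# * g zero + ∑ (allFin M) (λ j → 0# * g (suc j))
      ≈⟨ +-cong (*-identityˡ _) (trans (∑-cong (allFin M) (λ j → zeroˡ _)) (∑-0 (allFin M))) ⟩
    g zero + 0#  ≈⟨ +-identityʳ _ ⟩
    g zero ∎
  ∑-Kronecker {suc M} (suc i) g = begin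
    ∑ (allFin (suc M)) (λ j → ⟦ does (suc i ≟ᶠ j) ⟧ * g j) ≡⟨ ∑-allFin-suc (λ j → ⟦ does (suc i ≟ᶠ j) ⟧ * g j) ⟩
    0# * g zero + ∑ (allFin M) (λ j → ⟦ does (i ≟ᶠ j) ⟧ * g (suc j))
      ≈⟨ +-cong (zeroˡ _) (∑-Kronecker i (g ∘ suc)) ⟩
    0# + g (suc i) ≈⟨ +-identityˡ _ ⟩
    g (suc i) ∎

  -- Put the letter `a` in front of every proper word of length n: the result is proper unless that
  -- word itself starts with `a`.
  pathSumFrom-suc : ∀ a n → pathSumFrom a (suc n) + x a * pathSumFrom a n ≈ x a * pathSum n
  pathSumFrom-suc a zero = begin
    (⟦ true ⟧ * (x a * 1#) + 0#) + x a * 0# ≈⟨ solve 1 (λ y → (con 1 :* (y :* con 1) :+ con 0) :+ y :* con 0 := y :* (con 1 :* con 1 :+ con 0)) refl (x a) ⟩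
    x a * (1# * 1# + 0#) ∎
  pathSumFrom-suc a (suc n) = begin
    ∑ (colorings N (suc n)) (λ κ → weight (a ∷ κ)) + x a * ∑ κs (λ κ → weight (a ∷ κ))
      -- A Kronecker delta spreads the words starting with `a` over all first letters `b`, so that
      -- the two sums can be compared one `b` at a time.
      ≈⟨ +-cong (∑-colorings n _)
           (*-congˡ (sym (∑-Kronecker a (λ b → ∑ κs (λ κ → weight (b ∷ κ)))))) ⟩
    ∑ as (λ b → ∑ κs (λ κ → weight (a ∷ b ∷ κ))) + x a * ∑ as (λ b → ⟦ does (a ≟ᶠ b) ⟧ * ∑ κs (λ κ → weight (b ∷ κ)))
      ≈⟨ +-congˡ (sym (*-∑ as (x a) _)) ⟩
    ∑ as (λ b → ∑ κs (λ κ → weight (a ∷ b ∷ κ))) + ∑ as (λ b → x a * (⟦ does (a ≟ᶠ b) ⟧ * ∑ κs (λ κ → weight (b ∷ κ))))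
      ≈⟨ sym (∑-+ as _ _) ⟩
    ∑ as (λ b → ∑ κs (λ κ → weight (a ∷ b ∷ κ)) + x a * (⟦ does (a ≟ᶠ b) ⟧ * ∑ κs (λ κ → weight (b ∷ κ))))
      ≈⟨ ∑-cong as step ⟩
    ∑ as (λ b → x a * ∑ κs (λ κ → weight (b ∷ κ)))
      ≈⟨ *-∑ as (x a) _ ⟩
    x a * ∑ as (λ b → ∑ κs (λ κ → weight (b ∷ κ)))
      ≈⟨ *-congˡ (sym (∑-colorings n weight)) ⟩
    x a * pathSum (suc n) ∎
    where
    as = allFin N
    κs = colorings N n
    step : ∀ b → ∑ κs (λ κ → weight (a ∷ b ∷ κ)) + x a * (⟦ does (a ≟ᶠ b) ⟧ * ∑ κs (λ κ → weight (b ∷ κ)))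
               ≈ x a * ∑ κs (λ κ → weight (b ∷ κ))
    step b = begin
      ∑ κs (λ κ → weight (a ∷ b ∷ κ)) + x a * (⟦ does (a ≟ᶠ b) ⟧ * s)
        ≈⟨ +-congʳ (trans (∑-cong κs (λ κ → trans (weight-∷ a (b ∷ κ)) (sym (*-assoc _ _ _)))) (*-∑ κs _ _)) ⟩
      (⟦ differ a b ⟧ * x a) * s + x a * (⟦ does (a ≟ᶠ b) ⟧ * s)
        ≈⟨ solve 4 (λ p q y s → (p :* y) :* s :+ y :* (q :* s) := (p :+ q) :* (y :* s)) refl _ _ _ _ ⟩
      (⟦ differ a b ⟧ + ⟦ does (a ≟ᶠ b) ⟧) * (x a * s)
        ≈⟨ *-congʳ (⟦⟧-not (does (a ≟ᶠ b))) ⟩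
      1# * (x a * s) ≈⟨ *-identityˡ _ ⟩
      x a * s ∎
      where s = ∑ κs (λ κ → weight (b ∷ κ))

  -- Distinct colors a and b cannot both clash with the first letter of κ, hence
  -- [a≠b][a≠c][b≠c] = [a≠b]([a≠c] + [b≠c] - 1).
  inclusion-exclusion : ∀ {n} a b (κ : Vec (Fin N) n) →
    ⟦ differ a b ⟧ * (⟦ extends a κ ⟧ * ⟦ extends b κ ⟧) + ⟦ differ a b ⟧
      ≈ ⟦ differ a b ⟧ * ⟦ extends b κ ⟧ + ⟦ differ a b ⟧ * ⟦ extends a κ ⟧
  inclusion-exclusion a b [] = solve 1 (λ p → p :* (con 1 :* con 1) :+ p := p :* con 1 :+ p :* con 1) refl _
  inclusion-exclusion a b (c ∷ κ) with a ≟ᶠ b | a ≟ᶠ c | b ≟ᶠ c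
  ... | yes _  | _     | _     = solve 2 (λ p q → con 0 :* (p :* q) :+ con 0 := con 0 :* q :+ con 0 :* p) refl _ _
  ... | no a≢b | yes p | yes q = ⊥-elim (a≢b (≡.trans p (≡.sym q)))
  ... | no _   | yes _ | no _  = solve 0 (con 1 :* (con 0 :* con 1) :+ con 1 := con 1 :* con 1 :+ con 1 :* con 0) refl
  ... | no _   | no _  | yes _ = solve 0 (con 1 :* (con 1 :* con 0) :+ con 1 := con 1 :* con 0 :+ con 1 :* con 1) refl
  ... | no _   | no _  | no _  = solve 0 (con 1 :* (con 1 :* con 1) :+ con 1 := con 1 :* con 1 :+ con 1 :* con 1) refl

  differ-sym : ∀ (a b : Fin N) → differ a b ≡.≡ differ b a
  differ-sym a b with a ≟ᶠ b | b ≟ᶠ a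
  ... | yes _ | yes _ = ≡.refl
  ... | no _  | no _  = ≡.refl
  ... | yes p | no ¬p = ⊥-elim (¬p (≡.sym p))
  ... | no ¬p | yes p = ⊥-elim (¬p (≡.sym p))

  -- The new vertex, its twin and the first vertex of `κ` form a triangle. Deleting either edge to
  -- `κ` leaves a path on n + 2 vertices, read as `a ∷ b ∷ κ` or as `b ∷ a ∷ κ`; deleting both
  -- leaves P_2 beside P_n. The identity holds already for each triple `a`, `b`, `κ`.
  twin-deletion : ∀ n → twinSum n + pathSum 2 * pathSum n ≈ pathSum (suc (suc n)) + pathSum (suc (suc n))
  twin-deletion n = begin
    twinSum n + pathSum 2 * pathSum n
      ≈⟨ +-cong (∑-cong as (λ a → ∑-colorings n _)) product ⟩
    ∑³ (λ a b κ → ⟦ isTwinColoring a (b ∷ κ) ⟧ * monomial (a ∷ b ∷ κ)) + ∑³ (λ a b κ → weight (a ∷ b ∷ []) * weight κ)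
      ≈⟨ sym (∑³-+ _ _) ⟩
    ∑³ (λ a b κ → ⟦ isTwinColoring a (b ∷ κ) ⟧ * monomial (a ∷ b ∷ κ) + weight (a ∷ b ∷ []) * weight κ)
      ≈⟨ ∑³-cong step ⟩
    ∑³ (λ a b κ → weight (a ∷ b ∷ κ) + weight (b ∷ a ∷ κ))
      ≈⟨ ∑³-+ _ _ ⟩
    ∑³ (λ a b κ → weight (a ∷ b ∷ κ)) + ∑³ (λ a b κ → weight (b ∷ a ∷ κ))
      -- Exchanging the summations over `a` and `b` turns the second sum into the first.
      ≈⟨ +-cong (sym expand) (trans (∑-swap as as _) (sym expand)) ⟩
    pathSum (suc (suc n)) + pathSum (suc (suc n)) ∎
    where
    as = allFin N
    κs = colorings N n
    ∑³ : (Fin N → Fin N → Vec (Fin N) n → Carrier) → Carrier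
    ∑³ g = ∑ as (λ a → ∑ as (λ b → ∑ κs (λ κ → g a b κ)))
    ∑³-cong : ∀ {g h} → (∀ a b κ → g a b κ ≈ h a b κ) → ∑³ g ≈ ∑³ h
    ∑³-cong p = ∑-cong as (λ a → ∑-cong as (λ b → ∑-cong κs (p a b)))
    ∑³-+ : ∀ g h → ∑³ (λ a b κ → g a b κ + h a b κ) ≈ ∑³ g + ∑³ h
    ∑³-+ g h = trans (∑-cong as (λ a → trans (∑-cong as (λ b → ∑-+ κs _ _)) (∑-+ as _ _))) (∑-+ as _ _)
    expand : pathSum (suc (suc n)) ≈ ∑³ (λ a b κ → weight (a ∷ b ∷ κ))
    expand = trans (∑-colorings (suc n) weight) (∑-cong as (λ a → ∑-colorings n _))
    product : pathSum 2 * pathSum n ≈ ∑³ (λ a b κ → weight (a ∷ b ∷ []) * weight κ)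
    product = begin
      pathSum 2 * pathSum n
        ≈⟨ *-congʳ (trans (∑-colorings 1 weight) (∑-cong as (λ a → trans (∑-colorings 0 _) (∑-cong as (λ b → +-identityʳ _))))) ⟩
      ∑ as (λ a → ∑ as (λ b → weight (a ∷ b ∷ []))) * pathSum n
        ≈⟨ trans (sym (∑-* as _ _)) (∑-cong as (λ a → trans (sym (∑-* as _ _)) (∑-cong as (λ b → sym (*-∑ κs _ weight))))) ⟩
      ∑³ (λ a b κ → weight (a ∷ b ∷ []) * weight κ) ∎
    step : ∀ a b κ → ⟦ isTwinColoring a (b ∷ κ) ⟧ * monomial (a ∷ b ∷ κ) + weight (a ∷ b ∷ []) * weight κ
                   ≈ weight (a ∷ b ∷ κ) + weight (b ∷ a ∷ κ)
    step a b κ = begin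
      ⟦ (differ a b ∧ extends a κ) ∧ isPathColoring (b ∷ κ) ⟧ * monomial (a ∷ b ∷ κ) + weight (a ∷ b ∷ []) * weight κ
        ≈⟨ +-cong
            (*-congʳ (trans (⟦⟧-∧ (differ a b ∧ extends a κ) (isPathColoring (b ∷ κ)))
                        (*-cong (⟦⟧-∧ (differ a b) (extends a κ)) (⟦⟧-∧ (extends b κ) (isPathColoring κ)))))
            (*-congʳ (*-congʳ (⟦⟧-∧ (differ a b) true))) ⟩
      ((d * p) * (q * o)) * (x a * (x b * m)) + ((d * 1#) * (x a * (x b * 1#))) * (o * m)
        ≈⟨ solve 7 (λ d p q o y z m →
             ((d :* p) :* (q :* o)) :* (y :* (z :* m)) :+ ((d :* con 1) :* (y :* (z :* con 1))) :* (o :* m)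
             := (d :* (p :* q) :+ d) :* (o :* (y :* (z :* m)))) refl _ _ _ _ _ _ _ ⟩
      (d * (p * q) + d) * (o * (x a * (x b * m)))
        ≈⟨ *-congʳ (inclusion-exclusion a b κ) ⟩
      (d * q + d * p) * (o * (x a * (x b * m)))
        ≈⟨ solve 7 (λ d p q o y z m → (d :* q :+ d :* p) :* (o :* (y :* (z :* m)))
             := d :* (y :* (q :* (z :* (o :* m)))) :+ d :* (z :* (p :* (y :* (o :* m))))) refl _ _ _ _ _ _ _ ⟩
      d * (x a * (q * (x b * weight κ))) + d * (x b * (p * (x a * weight κ)))
        ≈⟨ +-cong (*-congˡ (*-congˡ (sym (weight-∷ b κ))))
                  (*-cong (reflexive (≡.cong ⟦_⟧ (differ-sym a b))) (*-congˡ (sym (weight-∷ a κ)))) ⟩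
      d * (x a * weight (b ∷ κ)) + ⟦ differ b a ⟧ * (x b * weight (a ∷ κ))
        ≈⟨ +-cong (sym (weight-∷ a (b ∷ κ))) (sym (weight-∷ b (a ∷ κ))) ⟩
      weight (a ∷ b ∷ κ) + weight (b ∷ a ∷ κ) ∎
      where
      d = ⟦ differ a b ⟧
      p = ⟦ extends a κ ⟧
      q = ⟦ extends b κ ⟧
      o = ⟦ isPathColoring κ ⟧
      m = monomial κ

  ∑-colorings-∷ʳ : ∀ n (g : Vec (Fin N) (suc n) → Carrier) →
    ∑ (colorings N (suc n)) g ≈ ∑ (colorings N n) (λ κ → ∑ (allFin N) (λ a → g (κ ∷ʳ a)))
  ∑-colorings-∷ʳ zero g =
    trans (∑-colorings 0 g) (trans (∑-cong (allFin N) (λ a → +-identityʳ _)) (sym (+-identityʳ _)))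
  ∑-colorings-∷ʳ (suc n) g = begin
    ∑ (colorings N (suc (suc n))) g
      ≈⟨ ∑-colorings (suc n) g ⟩
    ∑ (allFin N) (λ c → ∑ (colorings N (suc n)) (λ κ → g (c ∷ κ)))
      ≈⟨ ∑-cong (allFin N) (λ c → ∑-colorings-∷ʳ n (λ κ → g (c ∷ κ))) ⟩
    ∑ (allFin N) (λ c → ∑ (colorings N n) (λ κ → ∑ (allFin N) (λ a → g (c ∷ (κ ∷ʳ a)))))
      ≈⟨ ∑-colorings n _ ⟨
    ∑ (colorings N (suc n)) (λ κ → ∑ (allFin N) (λ a → g (κ ∷ʳ a))) ∎

  -- Serves the twin at the last vertex of the path: reading words backwards moves that vertex to
  -- the front.
  ∑-colorings-reverse : ∀ n (g : Vec (Fin N) n → Carrier) →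
    ∑ (colorings N n) (λ κ → g (reverse κ)) ≈ ∑ (colorings N n) g
  ∑-colorings-reverse zero    g = refl
  ∑-colorings-reverse (suc n) g = begin
    ∑ (colorings N (suc n)) (λ κ → g (reverse κ))
      ≈⟨ ∑-colorings n _ ⟩
    ∑ (allFin N) (λ a → ∑ (colorings N n) (λ κ → g (reverse (a ∷ κ))))
      ≈⟨ ∑-cong (allFin N) (λ a → ∑-cong (colorings N n) (λ κ → reflexive (≡.cong g (reverse-∷ a κ)))) ⟩
    ∑ (allFin N) (λ a → ∑ (colorings N n) (λ κ → g (reverse κ ∷ʳ a)))
      ≈⟨ ∑-cong (allFin N) (λ a → ∑-colorings-reverse n (λ κ → g (κ ∷ʳ a))) ⟩
    ∑ (allFin N) (λ a → ∑ (colorings N n) (λ κ → g (κ ∷ʳ a)))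
      ≈⟨ ∑-swap (allFin N) (colorings N n) _ ⟩
    ∑ (colorings N n) (λ κ → ∑ (allFin N) (λ a → g (κ ∷ʳ a)))
      ≈⟨ ∑-colorings-∷ʳ n g ⟨
    ∑ (colorings N (suc n)) g ∎

  monomial-∷ʳ : ∀ {n} (κ : Vec (Fin N) n) a → monomial (κ ∷ʳ a) ≈ x a * monomial κ
  monomial-∷ʳ []      a = refl
  monomial-∷ʳ (b ∷ κ) a = trans (*-congˡ (monomial-∷ʳ κ a))
    (solve 3 (λ y z m → y :* (z :* m) := z :* (y :* m)) refl _ _ _)

  monomial-reverse : ∀ {n} (κ : Vec (Fin N) n) → monomial (reverse κ) ≈ monomial κ
  monomial-reverse []      = refl
  monomial-reverse (a ∷ κ) = begin
    monomial (reverse (a ∷ κ))    ≡⟨ ≡.cong monomial (reverse-∷ a κ) ⟩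
    monomial (reverse κ ∷ʳ a)     ≈⟨ monomial-∷ʳ (reverse κ) a ⟩
    x a * monomial (reverse κ)    ≈⟨ *-congˡ (monomial-reverse κ) ⟩
    x a * monomial κ              ∎

open import Data.Integer using (+_)
open import Relation.Binary.PropositionalEquality using (_≡_; _≢_; refl; sym; trans; cong; cong₂; subst; module ≡-Reasoning)
open import Defs

-- Power series in finitely many variables

Series[_] : ℕ → Set
Series[ N ] = Vec ℕ N → ℤ

module _ {N : ℕ} where
  infixl 6 _+ˢ_
  _+ˢ_ : Series[ N ] → Series[ N ] → Series[ N ]
  (f +ˢ g) α = f α ℤ.+ g α

  infix 4 _≈ˢ_
  _≈ˢ_ : Series[ N ] → Series[ N ] → Set
  f ≈ˢ g = ∀ α → f α ≡ g α

  0ˢ : Series[ N ]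
  0ˢ _ = 0ℤ

  -ˢ_ : Series[ N ] → Series[ N ]
  (-ˢ f) α = ℤ.- f α

coefficient : ∀ {N} → Series[ suc N ] → ℕ → Series[ N ]
coefficient f k α = f (k ∷ α)

-- The first variable is treated as the indeterminate of a univariate series over the series in the
-- others. Since `convolve` takes bare operations, the product is available before any ring law, and
-- the laws can then follow the same recursion on N.
mul : ∀ N → Series[ N ] → Series[ N ] → Series[ N ]
mul zero    f g []      = f [] ℤ.* g []
mul (suc N) f g (a ∷ α) = convolve _+ˢ_ (mul N) (coefficient f) (coefficient g) a α

one : ∀ N → Series[ N ]
one zero    []          = 1ℤ
one (suc N) (zero  ∷ α) = one N α
one (suc N) (suc _ ∷ α) = 0ℤ

bundle : ∀ N → IsCommutativeRing (_≈ˢ_ {N}) _+ˢ_ (mul N) -ˢ_ 0ˢ (one N) → CommutativeRing 0ℓ 0ℓ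
bundle N laws = record { isCommutativeRing = laws }

-- `coefficient` identifies series in N + 1 variables with univariate series over the series in N
-- variables. The operations match almost by computation, so the laws are pulled back along this
-- monomorphism.
isCommutativeRingˢ : ∀ N → IsCommutativeRing (_≈ˢ_ {N}) _+ˢ_ (mul N) -ˢ_ 0ˢ (one N)
isCommutativeRingˢ zero = RingMonomorphism.isCommutativeRing mono ℤ.+-*-isCommutativeRing
  where
  mono : IsRingMonomorphism
    (record { Carrier = Series[ 0 ] ; _≈_ = _≈ˢ_ ; _+_ = _+ˢ_ ; _*_ = mul 0 ; -_ = -ˢ_ ; 0# = 0ˢ ; 1# = one 0 })
    (CommutativeRing.rawRing ℤ.+-*-commutativeRing) (λ f → f [])
  mono = record
    { isRingHomomorphism = record
      { isSemiringHomomorphism = record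
        { isNearSemiringHomomorphism = record
          { +-isMonoidHomomorphism = record
            { isMagmaHomomorphism = record
              { isRelHomomorphism = record { cong = λ p → p [] }
              ; homo = λ f g → refl
              }
            ; ε-homo = refl
            }
          ; *-homo = λ f g → refl
          }
        ; 1#-homo = refl
        }
      ; -‿homo = λ f → refl
      }
    ; injective = λ { p [] → p }
    }
isCommutativeRingˢ (suc N) = RingMonomorphism.isCommutativeRing mono (CommutativeRing.isCommutativeRing S.seriesRing)
  where
  module S = Series (bundle N (isCommutativeRingˢ N))
  mono : IsRingMonomorphism
    (record { Carrier = Series[ suc N ] ; _≈_ = _≈ˢ_ ; _+_ = _+ˢ_ ; _*_ = mul (suc N) ; -_ = -ˢ_ ; 0# = 0ˢ ; 1# = one (suc N) })
    (CommutativeRing.rawRing S.seriesRing) coefficient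
  mono = record
    { isRingHomomorphism = record
      { isSemiringHomomorphism = record
        { isNearSemiringHomomorphism = record
          { +-isMonoidHomomorphism = record
            { isMagmaHomomorphism = record
              { isRelHomomorphism = record { cong = λ p k α → p (k ∷ α) }
              ; homo = λ f g k α → refl
              }
            ; ε-homo = λ k α → refl
            }
          ; *-homo = λ f g k α → refl
          }
        ; 1#-homo = λ { zero α → refl ; (suc k) α → refl }
        }
      ; -‿homo = λ f k α → refl
      }
    ; injective = λ { p (k ∷ α) → p k α }
    }

ringˢ : ∀ N → CommutativeRing 0ℓ 0ℓ
ringˢ N = bundle N (isCommutativeRingˢ N)

module ℤ∑ = Sums ℤ.+-*-commutativeRing
module _ {N : ℕ} where
  open Sums (ringˢ N) public using () renaming (∑ to ∑ˢ)

∑ˢ-eval : ∀ {N} {I : Set} (is : List I) (f : I → Series[ N ]) α → ∑ˢ is f α ≡ ℤ∑.∑ is (λ i → f i α)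
∑ˢ-eval []       f α = refl
∑ˢ-eval (i ∷ is) f α = cong (ℤ._+_ (f i α)) (∑ˢ-eval is f α)

foldr-map-∑ : ∀ {I : Set} (f : I → ℤ) (is : List I) → foldr ℤ._+_ 0ℤ (map f is) ≡ ℤ∑.∑ is f
foldr-map-∑ f []       = refl
foldr-map-∑ f (i ∷ is) = cong (ℤ._+_ (f i)) (foldr-map-∑ f is)

-- Connects the product used in the theorem with `mul`: the part `k` that `splits` takes from the
-- first exponent is the index of the convolution.
mul-splits : ∀ N (f g : Series[ N ]) α → ℤ∑.∑ (splits α) (λ s → f (proj₁ s) ℤ.* g (proj₂ s)) ≡ mul N f g α
mul-splits zero    f g []      = ℤ.+-identityʳ _
mul-splits (suc N) f g (a ∷ α) = begin
  ℤ∑.∑ (splits (a ∷ α)) (λ s → f (proj₁ s) ℤ.* g (proj₂ s))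
    ≡⟨ ℤ∑.∑-cartesianProductWith _ (upTo (suc a)) (splits α) _ ⟩
  ℤ∑.∑ (upTo (suc a)) (λ k → ℤ∑.∑ (splits α) (λ s → f (k ∷ proj₁ s) ℤ.* g (a ∸ k ∷ proj₂ s)))
    ≡⟨ ℤ∑.∑-cong (upTo (suc a)) (λ k → mul-splits N (coefficient f k) (coefficient g (a ∸ k)) α) ⟩
  ℤ∑.∑ (upTo (suc a)) (λ k → mul N (coefficient f k) (coefficient g (a ∸ k)) α)
    ≡⟨ ∑ˢ-eval (upTo (suc a)) (λ k → mul N (coefficient f k) (coefficient g (a ∸ k))) α ⟨
  ∑ˢ (upTo (suc a)) (λ k → mul N (coefficient f k) (coefficient g (a ∸ k))) α
    ≡⟨ Sums.✶-as-∑ (ringˢ N) (coefficient f) (coefficient g) a α ⟨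
  mul (suc N) f g (a ∷ α) ∎
  where open ≡-Reasoning

⊗-as-∑ : ∀ F G N α → (F ⊗ G) N α ≡ ℤ∑.∑ (splits α) (λ s → F N (proj₁ s) ℤ.* G N (proj₂ s))
⊗-as-∑ F G N α = trans (cong (foldr ℤ._+_ 0ℤ) (List.map-cong (λ _ → refl) (splits α)))
  (foldr-map-∑ (λ s → F N (proj₁ s) ℤ.* G N (proj₂ s)) (splits α))

⊗-mul : ∀ F G N α → (F ⊗ G) N α ≡ mul N (F N) (G N) α
⊗-mul F G N α = trans (⊗-as-∑ F G N α) (mul-splits N (F N) (G N) α)

𝟙-one : ∀ N α → 𝟙 N α ≡ one N α
𝟙-one N α = trans (cong (if_then 1ℤ else 0ℤ) (isYes≗does (VecAll.all? (ℕ._≟ 0) α))) (go N α)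
  where
  go : ∀ N α → (if does (VecAll.all? (ℕ._≟ 0) α) then 1ℤ else 0ℤ) ≡ one N α
  go zero    []          = refl
  go (suc N) (zero  ∷ α) = go N α
  go (suc N) (suc _ ∷ α) = refl

var : ∀ {N} → Fin N → Series[ N ]
var zero    (zero        ∷ α) = 0ℤ
var zero    (suc zero    ∷ α) = one _ α
var zero    (suc (suc _) ∷ α) = 0ℤ
var (suc i) (zero        ∷ α) = var i α
var (suc i) (suc _       ∷ α) = 0ℤ

module _ {N : ℕ} where
  private
    module S = Series (ringˢ N)
    module SR = CommutativeRing S.seriesRing

  -- Over the remaining variables, the first variable is the indeterminate, so multiplication by it
  -- shifts; every other variable is a constant and acts on each coefficient separately.
  var-zero-coefficient : coefficient (var {suc N} zero) S.≋ S.shift (S.constant (one N))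
  var-zero-coefficient zero          α = refl
  var-zero-coefficient (suc zero)    α = refl
  var-zero-coefficient (suc (suc k)) α = refl

  var-suc-coefficient : ∀ (i : Fin N) → coefficient (var (suc i)) S.≋ S.constant (var i)
  var-suc-coefficient i zero    α = refl
  var-suc-coefficient i (suc k) α = refl

  mul-var-zero : ∀ (f : Series[ suc N ]) k α →
                 mul (suc N) (var zero) f (k ∷ α) ≡ S.shift (coefficient f) k α
  mul-var-zero f k α = lemma k α
    where
    lemma : coefficient (var zero) S.✶ coefficient f S.≋ S.shift (coefficient f)
    lemma = SR.trans (S.✶-cong {g = coefficient f} var-zero-coefficient (λ _ _ → refl))
      (SR.trans (S.shift-✶ (S.constant (one N)) (coefficient f)) (λ { zero α → refl ; (suc k) → S.✶-identityˡ (coefficient f) k }))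

  mul-var-suc : ∀ (i : Fin N) (f : Series[ suc N ]) k α →
                mul (suc N) (var (suc i)) f (k ∷ α) ≡ mul N (var i) (coefficient f k) α
  mul-var-suc i f k α = lemma k α
    where
    lemma : coefficient (var (suc i)) S.✶ coefficient f S.≋ λ k → mul N (var i) (coefficient f k)
    lemma = SR.trans (S.✶-cong {g = coefficient f} (var-suc-coefficient i) (λ _ _ → refl))
      (S.constant-✶ (var i) (coefficient f))

mul-var-cong : ∀ {N} (i : Fin N) {f g : Series[ N ]} → f ≈ˢ g → mul N (var i) f ≈ˢ mul N (var i) g
mul-var-cong {N} i p = CommutativeRing.*-congˡ (ringˢ N) {var i} p

mul-zeroʳ : ∀ {N} (f : Series[ N ]) → mul N f 0ˢ ≈ˢ 0ˢ
mul-zeroʳ {N} = CommutativeRing.zeroʳ (ringˢ N)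

-- Colorings and monomials

-- The monomial with exponent vector `β`, given by its coefficients.
δ : ∀ {N} → Vec ℕ N → Series[ N ]
δ β α = if does (Vec.≡-dec ℕ._≟_ β α) then 1ℤ else 0ℤ

if-∧ : ∀ p q (a : ℤ) → (if p ∧ q then a else 0ℤ) ≡ (if p then (if q then a else 0ℤ) else 0ℤ)
if-∧ true  q a = refl
if-∧ false q a = refl

δ-∷ : ∀ {N} b (β : Vec ℕ N) a α → δ (b ∷ β) (a ∷ α) ≡ (if does (b ℕ.≟ a) then δ β α else 0ℤ)
δ-∷ b β a α = if-∧ (does (b ℕ.≟ a)) _ 1ℤ

mul-var-δ : ∀ {N} (i : Fin N) β α → mul N (var i) (δ β) α ≡ δ (updateAt β i suc) α
mul-var-δ zero    (b ∷ β) (zero  ∷ α) = mul-var-zero (δ (b ∷ β)) 0 α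
mul-var-δ zero    (b ∷ β) (suc a ∷ α) = begin
  mul _ (var zero) (δ (b ∷ β)) (suc a ∷ α)  ≡⟨ mul-var-zero (δ (b ∷ β)) (suc a) α ⟩
  δ (b ∷ β) (a ∷ α)                         ≡⟨ δ-∷ b β a α ⟩
  (if does (b ℕ.≟ a) then δ β α else 0ℤ)    ≡⟨ δ-∷ (suc b) β (suc a) α ⟨
  δ (suc b ∷ β) (suc a ∷ α)                 ∎
  where open ≡-Reasoning
mul-var-δ {suc N} (suc i) (b ∷ β) (a ∷ α) = begin
  mul (suc N) (var (suc i)) (δ (b ∷ β)) (a ∷ α)   ≡⟨ mul-var-suc i (δ (b ∷ β)) a α ⟩
  mul N (var i) (λ γ → δ (b ∷ β) (a ∷ γ)) α       ≡⟨ mul-var-cong i (δ-∷ b β a) α ⟩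
  mul N (var i) (λ γ → if does (b ℕ.≟ a) then δ β γ else 0ℤ) α ≡⟨ lemma (does (b ℕ.≟ a)) ⟩
  (if does (b ℕ.≟ a) then δ (updateAt β i suc) α else 0ℤ) ≡⟨ δ-∷ b (updateAt β i suc) a α ⟨
  δ (b ∷ updateAt β i suc) (a ∷ α) ∎
  where
  open ≡-Reasoning
  lemma : ∀ t → mul N (var i) (λ γ → if t then δ β γ else 0ℤ) α ≡ (if t then δ (updateAt β i suc) α else 0ℤ)
  lemma true  = mul-var-δ i β α
  lemma false = mul-zeroʳ (var i) α

updateAt-tabulate : ∀ {N} (g : Fin N → ℕ) c →
  updateAt (tabulate g) c suc ≡ tabulate (λ i → if does (i ≟ᶠ c) then suc (g i) else g i)
updateAt-tabulate g zero    = refl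
updateAt-tabulate g (suc c) = cong (g zero ∷_) (updateAt-tabulate (g ∘ suc) c)

content-∷ : ∀ {N n} c (κ : Vec (Fin N) n) → content (c ∷ κ) ≡ updateAt (content κ) c suc
content-∷ c κ = sym (trans (updateAt-tabulate (λ i → Vec.count (i ≟ᶠ_) κ) c) (Vec.tabulate-cong step))
  where
  step : ∀ i → (if does (i ≟ᶠ c) then suc (Vec.count (i ≟ᶠ_) κ) else Vec.count (i ≟ᶠ_) κ) ≡ Vec.count (i ≟ᶠ_) (c ∷ κ)
  step i with does (i ≟ᶠ c)
  ... | true  = refl
  ... | false = refl

length-filter : ∀ {I : Set} {P : I → Set} (P? : ∀ i → Dec (P i)) (is : List I) →
  + length (filter P? is) ≡ ℤ∑.∑ is (λ i → if does (P? i) then 1ℤ else 0ℤ)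
length-filter P? []       = refl
length-filter P? (i ∷ is) with does (P? i)
... | true  = cong (ℤ._+_ 1ℤ) (length-filter P? is)
... | false = trans (length-filter P? is) (sym (ℤ.+-identityˡ _))

module _ {N : ℕ} where
  open Words (ringˢ N) N var public using (monomial; ⟦_⟧)

  monomial-δ : ∀ {n} (κ : Vec (Fin N) n) → monomial κ ≈ˢ δ (content κ)
  monomial-δ []      α = lemma N α
    where
    lemma : ∀ M (α : Vec ℕ M) → one M α ≡ δ (tabulate (λ _ → 0)) α
    lemma zero    []          = refl
    lemma (suc M) (zero  ∷ α) = lemma M α
    lemma (suc M) (suc _ ∷ α) = refl
  monomial-δ (c ∷ κ) α = begin
    mul N (var c) (monomial κ) α       ≡⟨ mul-var-cong c (monomial-δ κ) α ⟩
    mul N (var c) (δ (content κ)) α    ≡⟨ mul-var-δ c (content κ) α ⟩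
    δ (updateAt (content κ) c suc) α   ≡⟨ cong (λ β → δ β α) (content-∷ c κ) ⟨
    δ (content (c ∷ κ)) α              ∎
    where open ≡-Reasoning

  -- A proper coloring contributes 1 to the coefficient at its content and 0 elsewhere, which is
  -- what its monomial does. This turns the count in `X` into a sum in the ring, where the word
  -- identities apply.
  X-as-sum : ∀ {n} (G : Graph n) (α : Vec ℕ N) →
    X G N α ≡ ∑ˢ (colorings N n) (λ κ → mul N ⟦ does (proper? G κ) ⟧ (monomial κ)) α
  X-as-sum {n} G α = begin
    X G N α
      ≡⟨ length-filter _ (colorings N n) ⟩
    ℤ∑.∑ (colorings N n) (λ κ → if does (proper? G κ ×-dec Vec.≡-dec ℕ._≟_ (content κ) α) then 1ℤ else 0ℤ)
      ≡⟨ ℤ∑.∑-cong (colorings N n) step ⟩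
    ℤ∑.∑ (colorings N n) (λ κ → mul N ⟦ does (proper? G κ) ⟧ (monomial κ) α)
      ≡⟨ ∑ˢ-eval (colorings N n) _ α ⟨
    ∑ˢ (colorings N n) (λ κ → mul N ⟦ does (proper? G κ) ⟧ (monomial κ)) α ∎
    where
    open ≡-Reasoning
    module R = CommutativeRing (ringˢ N)
    scale : ∀ t κ → (if t then δ (content κ) α else 0ℤ) ≡ mul N ⟦ t ⟧ (monomial {n} κ) α
    scale true  κ = sym (trans (R.*-identityˡ (monomial κ) α) (monomial-δ κ α))
    scale false κ = sym (R.zeroˡ (monomial κ) α)
    step : ∀ κ → (if does (proper? G κ ×-dec Vec.≡-dec ℕ._≟_ (content κ) α) then 1ℤ else 0ℤ)
               ≡ mul N ⟦ does (proper? G κ) ⟧ (monomial κ) α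
    step κ = trans (if-∧ (does (proper? G κ)) _ 1ℤ) (scale (does (proper? G κ)) κ)

-- Elementary symmetric functions

-- The coefficients of e_k decided one exponent at a time: an exponent 1 uses up one unit of k, a
-- larger one excludes the monomial. Inductions on the number of variables follow this form more
-- easily than the test on the whole vector in `e`.
elementary : ∀ {N} → Vec ℕ N → ℕ → ℤ
elementary []                zero    = 1ℤ
elementary []                (suc k) = 0ℤ
elementary (zero        ∷ α) k       = elementary α k
elementary (suc zero    ∷ α) zero    = 0ℤ
elementary (suc zero    ∷ α) (suc k) = elementary α k
elementary (suc (suc _) ∷ α) k       = 0ℤ

e-elementary : ∀ k N α → e k N α ≡ elementary α k
e-elementary k N α =
  trans (cong (if_then 1ℤ else 0ℤ) (isYes≗does (VecAll.all? (ℕ._≤? 1) α ×-dec (Vec.sum α ℕ.≟ k)))) (go N α k)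
  where
  go : ∀ N α k → (if does (VecAll.all? {n = N} (ℕ._≤? 1) α) ∧ does (Vec.sum α ℕ.≟ k) then 1ℤ else 0ℤ) ≡ elementary α k
  go zero    []                zero    = refl
  go zero    []                (suc k) = refl
  go (suc N) (zero        ∷ α) k       = go N α k
  go (suc N) (suc zero    ∷ α) zero    = cong (if_then 1ℤ else 0ℤ) (∧-zeroʳ _)
  go (suc N) (suc zero    ∷ α) (suc k) = go N α k
  go (suc N) (suc (suc _) ∷ α) k       = refl

-- The part of e k consisting of the monomials divisible by the i-th variable.
elementaryThrough : ∀ {N} → Fin N → Vec ℕ N → ℕ → ℤ
elementaryThrough zero    (zero        ∷ α) k       = 0ℤ
elementaryThrough zero    (suc zero    ∷ α) k       = elementary (1 ∷ α) k
elementaryThrough zero    (suc (suc _) ∷ α) k       = 0ℤ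
elementaryThrough (suc i) (zero        ∷ α) k       = elementaryThrough i α k
elementaryThrough (suc i) (suc zero    ∷ α) zero    = 0ℤ
elementaryThrough (suc i) (suc zero    ∷ α) (suc k) = elementaryThrough i α k
elementaryThrough (suc i) (suc (suc _) ∷ α) k       = 0ℤ

elementaryThrough-0 : ∀ {N} (i : Fin N) α → elementaryThrough i α 0 ≡ 0ℤ
elementaryThrough-0 zero    (zero        ∷ α) = refl
elementaryThrough-0 zero    (suc zero    ∷ α) = refl
elementaryThrough-0 zero    (suc (suc _) ∷ α) = refl
elementaryThrough-0 (suc i) (zero        ∷ α) = elementaryThrough-0 i α
elementaryThrough-0 (suc i) (suc zero    ∷ α) = refl
elementaryThrough-0 (suc i) (suc (suc _) ∷ α) = refl

-- Multiply each squarefree monomial of degree k by x_i. If x_i was absent, the product is a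
-- squarefree monomial of degree k + 1 through x_i; otherwise x_i now occurs squared, and these
-- products form the second summand.
elementaryThrough-suc : ∀ {N} (i : Fin N) α k →
  elementaryThrough i α (suc k) ℤ.+ mul N (var i) (λ β → elementaryThrough i β k) α
    ≡ mul N (var i) (λ β → elementary β k) α
elementaryThrough-suc {suc N} zero (a ∷ α) k =
  trans (cong (ℤ._+_ (elementaryThrough zero (a ∷ α) (suc k))) (mul-var-zero (λ β → elementaryThrough zero β k) a α))
    (trans (go a) (sym (mul-var-zero (λ β → elementary β k) a α)))
  where
  module S = Series (ringˢ N)
  go : ∀ a → elementaryThrough zero (a ∷ α) (suc k) ℤ.+ S.shift (coefficient (λ β → elementaryThrough zero β k)) a α
           ≡ S.shift (coefficient (λ β → elementary β k)) a α
  go zero                = refl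
  go (suc zero)          = ℤ.+-identityʳ _
  go (suc (suc zero))    = ℤ.+-identityˡ _
  go (suc (suc (suc a))) = refl
elementaryThrough-suc {suc N} (suc i) (a ∷ α) k =
  trans (cong (ℤ._+_ (elementaryThrough (suc i) (a ∷ α) (suc k))) (mul-var-suc i (λ β → elementaryThrough (suc i) β k) a α))
    (trans (go a k) (sym (mul-var-suc i (λ β → elementary β k) a α)))
  where
  go : ∀ a k → elementaryThrough (suc i) (a ∷ α) (suc k) ℤ.+ mul N (var i) (λ β → elementaryThrough (suc i) (a ∷ β) k) α
             ≡ mul N (var i) (λ β → elementary (a ∷ β) k) α
  go zero          k       = elementaryThrough-suc i α k
  -- In total degree 1 the other variable already takes the whole degree, leaving none for x_i.
  go (suc zero)    zero    = trans (cong (ℤ._+ mul N (var i) (λ _ → 0ℤ) α) (elementaryThrough-0 i α)) (ℤ.+-identityˡ _)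
  go (suc zero)    (suc k) = elementaryThrough-suc i α k
  go (suc (suc a)) k       = ℤ.+-identityˡ _

-- A squarefree monomial of degree k is divisible by exactly k variables, so it is counted k times.
∑-elementaryThrough : ∀ {N} (α : Vec ℕ N) k →
  ℤ∑.∑ (allFin N) (λ i → elementaryThrough i α k) ≡ + k ℤ.* elementary α k
∑-elementaryThrough []      zero    = refl
∑-elementaryThrough []      (suc k) = sym (ℤ.*-zeroʳ (+ suc k))
∑-elementaryThrough {suc N} (a ∷ α) k =
  trans (ℤ∑.∑-allFin-suc (λ i → elementaryThrough i (a ∷ α) k)) (go a k)
  where
  go : ∀ a k → elementaryThrough zero (a ∷ α) k ℤ.+ ℤ∑.∑ (allFin N) (λ i → elementaryThrough (suc i) (a ∷ α) k)
             ≡ + k ℤ.* elementary (a ∷ α) k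
  go zero          k       = trans (ℤ.+-identityˡ _) (∑-elementaryThrough α k)
  go (suc zero)    zero    = trans (ℤ.+-identityˡ _) (ℤ∑.∑-0 (allFin N))
  go (suc zero)    (suc k) = trans (cong (ℤ._+_ (elementary α k)) (∑-elementaryThrough α k))
                                   (sym (ℤ.suc-* (+ k) (elementary α k)))
  go (suc (suc a)) k       = trans (ℤ.+-identityˡ _) (trans (ℤ∑.∑-0 (allFin N)) (sym (ℤ.*-zeroʳ (+ k))))

-- Properness as a condition on words

T-not-does : ∀ {P : Set} (P? : Dec P) → T (not (does P?)) → ¬ P
T-not-does (no ¬p) _ = ¬p

not-does-T : ∀ {P : Set} (P? : Dec P) → ¬ P → T (not (does P?))
not-does-T (no _)  _  = tt
not-does-T (yes p) ¬p = ⊥-elim (¬p p)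

does-T : ∀ {P : Set} (P? : Dec P) b → (P → T b) → (T b → P) → does P? ≡ b
does-T P? true  _ g = dec-true P? (g tt)
does-T P? false f _ = dec-false P? f

module _ {N : ℕ} where

  proper⇒isPathColoring : ∀ {n} (κ : Vec (Fin N) n) → Proper (path n) κ → T (isPathColoring κ)
  proper⇒isPathColoring []      pr = tt
  proper⇒isPathColoring (a ∷ κ) pr = Equivalence.from T-∧
    (first κ pr , proper⇒isPathColoring κ (λ i j i~j → pr (suc i) (suc j) (Sum.map (cong suc) (cong suc) i~j)))
    where
    first : ∀ {n} (κ : Vec (Fin N) n) → Proper (path (suc n)) (a ∷ κ) → T (extends a κ)
    first []      pr = tt
    first (b ∷ κ) pr = not-does-T (a ≟ᶠ b) (pr zero (suc zero) (inj₁ refl))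

  isPathColoring⇒proper : ∀ {n} (κ : Vec (Fin N) n) → T (isPathColoring κ) → Proper (path n) κ
  isPathColoring⇒proper (a ∷ κ) t = go (proj₁ (Equivalence.to T-∧ t)) (isPathColoring⇒proper κ (proj₂ (Equivalence.to T-∧ t)))
    where
    -- The equation is what adjacency of the vertices `zero` and `suc j` computes to; it forces `j`
    -- to be `zero`.
    adjacent : ∀ {n} (κ : Vec (Fin N) n) → T (extends a κ) → ∀ j → 1 ≡ suc (toℕ j) → a ≢ lookup κ j
    adjacent (b ∷ κ) t zero _ = T-not-does (a ≟ᶠ b) t
    go : T (extends a κ) → Proper (path _) κ → Proper (path _) (a ∷ κ)
    go t pr zero    (suc j) (inj₁ p) eq = adjacent κ t j p eq
    go t pr (suc i) zero    (inj₂ p) eq = adjacent κ t i p (sym eq)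
    go t pr (suc i) (suc j) (inj₁ p) eq = pr i j (inj₁ (ℕ.suc-injective p)) eq
    go t pr (suc i) (suc j) (inj₂ p) eq = pr i j (inj₂ (ℕ.suc-injective p)) eq

  does-proper-path : ∀ {n} (κ : Vec (Fin N) n) → does (proper? (path n) κ) ≡ isPathColoring κ
  does-proper-path κ = does-T (proper? (path _) κ) _ (proper⇒isPathColoring κ) (isPathColoring⇒proper κ)

  does-proper-twin : ∀ {n} a (κ : Vec (Fin N) (suc n)) →
    does (proper? (twin (path (suc n)) zero) (a ∷ κ)) ≡ isTwinColoring a κ
  does-proper-twin {n} a (b ∷ κ) = does-T (proper? (twin (path (suc n)) zero) (a ∷ b ∷ κ)) _ to from
    where
    to : Proper (twin (path (suc n)) zero) (a ∷ b ∷ κ) → T (isTwinColoring a (b ∷ κ))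
    to pr = Equivalence.from T-∧
      ( Equivalence.from T-∧ (not-does-T (a ≟ᶠ b) (pr zero (suc zero) (inj₁ refl)) , second κ (λ j p → pr zero (suc (suc j)) (inj₂ (inj₁ p))))
      , proper⇒isPathColoring (b ∷ κ) (λ i j → pr (suc i) (suc j)))
      where
      second : ∀ {n} (κ : Vec (Fin N) n) → (∀ j → 1 ≡ suc (toℕ j) → a ≢ lookup κ j) → T (extends a κ)
      second []      h = tt
      second (c ∷ κ) h = not-does-T (a ≟ᶠ c) (h zero refl)
    from : T (isTwinColoring a (b ∷ κ)) → Proper (twin (path (suc n)) zero) (a ∷ b ∷ κ)
    from t = go
      where
      t₁ = Equivalence.to T-∧ t
      t₂ = Equivalence.to T-∧ (proj₁ t₁)
      pr = isPathColoring⇒proper (b ∷ κ) (proj₂ t₁)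
      adjacent : ∀ {n} (κ : Vec (Fin N) n) → T (extends a κ) → ∀ j → 1 ≡ suc (toℕ j) → a ≢ lookup κ j
      adjacent (b ∷ κ) t zero _ = T-not-does (a ≟ᶠ b) t
      near : ∀ j → j ≡ zero ⊎ Graph._~_ (path (suc n)) zero j → a ≢ lookup (b ∷ κ) j
      near zero    (inj₁ _)        = T-not-does (a ≟ᶠ b) (proj₁ t₂)
      near zero    (inj₂ (inj₁ ()))
      near zero    (inj₂ (inj₂ ()))
      near (suc j) (inj₂ (inj₁ p)) = adjacent κ (proj₂ t₂) j p
      go : Proper (twin (path (suc n)) zero) (a ∷ b ∷ κ)
      go zero    (suc j) p = near j p
      go (suc i) zero    p = near i p ∘ sym
      go (suc i) (suc j) p = pr i j p

-- Reversing a path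

lookup-∷ʳ-inject₁ : ∀ {A : Set} {n} (xs : Vec A n) x i → lookup (xs ∷ʳ x) (inject₁ i) ≡ lookup xs i
lookup-∷ʳ-inject₁ (y ∷ xs) x zero    = refl
lookup-∷ʳ-inject₁ (y ∷ xs) x (suc i) = lookup-∷ʳ-inject₁ xs x i

lookup-∷ʳ-fromℕ : ∀ {A : Set} {n} (xs : Vec A n) x → lookup (xs ∷ʳ x) (fromℕ n) ≡ x
lookup-∷ʳ-fromℕ []       x = refl
lookup-∷ʳ-fromℕ (y ∷ xs) x = lookup-∷ʳ-fromℕ xs x

lookup-reverse-opposite : ∀ {A : Set} {n} (xs : Vec A n) i → lookup (reverse xs) (opposite i) ≡ lookup xs i
lookup-reverse-opposite (x ∷ xs) zero    =
  trans (cong (λ ys → lookup ys (fromℕ _)) (reverse-∷ x xs)) (lookup-∷ʳ-fromℕ (reverse xs) x)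
lookup-reverse-opposite (x ∷ xs) (suc i) =
  trans (cong (λ ys → lookup ys (inject₁ (opposite i))) (reverse-∷ x xs))
    (trans (lookup-∷ʳ-inject₁ (reverse xs) x (opposite i)) (lookup-reverse-opposite xs i))

opposite-adjacent : ∀ {n} {i j : Fin n} → suc (toℕ i) ≡ toℕ j → suc (toℕ (opposite j)) ≡ toℕ (opposite i)
opposite-adjacent {n} {i} {j} p = begin
  suc (toℕ (opposite j))   ≡⟨ cong suc (opposite-prop j) ⟩
  suc (n ∸ suc (toℕ j))    ≡⟨ ℕ.+-∸-assoc 1 (toℕ<n j) ⟨
  n ∸ toℕ j                ≡⟨ cong (n ∸_) p ⟨
  n ∸ suc (toℕ i)          ≡⟨ opposite-prop i ⟨
  toℕ (opposite i)         ∎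
  where open ≡-Reasoning

module _ {N n : ℕ} where
  private
    -- The isomorphism between the twins at opposite vertices: the new vertex stays and the path is
    -- reversed.
    flip : Fin (suc n) → Fin (suc n)
    flip zero    = zero
    flip (suc i) = suc (opposite i)

    path-flip : ∀ {i j : Fin n} → Graph._~_ (path n) i j → Graph._~_ (path n) (opposite i) (opposite j)
    path-flip {i} {j} (inj₁ p) = inj₂ (opposite-adjacent {i = i} {j} p)
    path-flip {i} {j} (inj₂ p) = inj₁ (opposite-adjacent {i = j} {i} p)

    near-flip : ∀ (v j : Fin n) → j ≡ v ⊎ Graph._~_ (path n) v j →
                opposite j ≡ opposite v ⊎ Graph._~_ (path n) (opposite v) (opposite j)
    near-flip v j = Sum.map (cong opposite) (path-flip {v} {j})

    twin-flip : ∀ (v : Fin n) i j → TwinAdj (path n) v i j → TwinAdj (path n) (opposite v) (flip i) (flip j)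
    twin-flip v zero    (suc j) p = near-flip v j p
    twin-flip v (suc i) zero    p = near-flip v i p
    twin-flip v (suc i) (suc j) p = path-flip {i} {j} p

    lookup-flip : ∀ a (κ : Vec (Fin N) n) i → lookup (a ∷ reverse κ) (flip i) ≡ lookup (a ∷ κ) i
    lookup-flip a κ zero    = refl
    lookup-flip a κ (suc i) = lookup-reverse-opposite κ i

    unreverse : ∀ v a (κ : Vec (Fin N) n) → Proper (twin (path n) (opposite v)) (a ∷ reverse κ) →
                Proper (twin (path n) v) (a ∷ κ)
    unreverse v a κ pr i j p eq =
      pr (flip i) (flip j) (twin-flip v i j p) (trans (lookup-flip a κ i) (trans eq (sym (lookup-flip a κ j))))

  does-proper-twin-reverse : ∀ v a (κ : Vec (Fin N) n) →
    does (proper? (twin (path n) v) (a ∷ κ)) ≡ does (proper? (twin (path n) (opposite v)) (a ∷ reverse κ))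
  does-proper-twin-reverse v a κ = does-⇔ (mk⇔ to (unreverse v a κ))
    (proper? (twin (path n) v) (a ∷ κ)) (proper? (twin (path n) (opposite v)) (a ∷ reverse κ))
    where
    to : Proper (twin (path n) v) (a ∷ κ) → Proper (twin (path n) (opposite v)) (a ∷ reverse κ)
    -- The converse is the same implication at the opposite vertex, because `opposite` and `reverse`
    -- are involutions.
    to pr = unreverse (opposite v) a (reverse κ)
      (subst (λ u → Proper (twin (path n) u) (a ∷ reverse (reverse κ))) (sym (opposite-involutive v))
        (subst (λ μ → Proper (twin (path n) v) (a ∷ μ)) (sym (reverse-involutive κ)) pr))

-- End vertices of a path

length≡1⇒∈-unique : ∀ {A : Set} {xs : List A} {x y} → length xs ≡ 1 → x ∈ xs → y ∈ xs → x ≡ y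
length≡1⇒∈-unique {xs = _ ∷ []} _ (here p) (here q) = trans p (sym q)

-- A vertex with path vertices on both sides has the neighbors `left` and `right`. Degree 1 would
-- make them equal, although their positions differ by 2.
isEndVertex⇒extreme : ∀ n (v : Fin (suc n)) → IsEndVertex (suc n) v → v ≡ zero ⊎ opposite v ≡ zero
isEndVertex⇒extreme n       zero    end      = inj₁ refl
isEndVertex⇒extreme zero    (suc ()) end
isEndVertex⇒extreme (suc n) (suc u) (inj₂ deg) with suc (toℕ u) ℕ.<? suc n
... | no  p = inj₂ (toℕ-injective (trans (opposite-prop (suc u)) (ℕ.m≤n⇒m∸n≡0 (ℕ.≮⇒≥ p))))
... | yes p = ⊥-elim (ℕ.<-irrefl {toℕ u} {suc (suc (toℕ u))}
    (trans (sym (toℕ-inject₁ u)) (trans (cong toℕ same) (toℕ-fromℕ< (ℕ.s≤s p)))) (ℕ.m≤n⇒m≤1+n ℕ.≤-refl))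
  where
  open Graph (path (suc (suc n)))
  left right : Fin (suc (suc n))
  left  = inject₁ u
  right = fromℕ< (ℕ.s≤s p)
  same : left ≡ right
  same = length≡1⇒∈-unique deg
    (∈-filter⁺ (suc u ~?_) (∈-allFin left)  (inj₂ (cong suc (toℕ-inject₁ u))))
    (∈-filter⁺ (suc u ~?_) (∈-allFin right) (inj₁ (sym (toℕ-fromℕ< (ℕ.s≤s p)))))

-- Path recurrence and triple deletion

module _ (N : ℕ) where
  private
    module R = CommutativeRing (ringˢ N)
    module M = Mult R.semiring
    module W = Words (ringˢ N) N var
    module Σ = Sums (ringˢ N)
    module S = Series (ringˢ N)

  XP-pathSum : ∀ n → XP n N ≈ˢ W.pathSum n
  XP-pathSum n α = trans (X-as-sum (path n) α)
    (Σ.∑-cong (colorings N n) (λ κ → R.*-congʳ (R.reflexive (cong W.⟦_⟧ (does-proper-path κ)))) α)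

  -- At the vertex `zero` the words are read as they stand. At the other end they are reversed
  -- first, which changes neither their monomials nor the sum over all words.
  twin-twinSum : ∀ n (v : Fin (suc n)) → IsEndVertex (suc n) v → X (twin (path (suc n)) v) N ≈ˢ W.twinSum n
  twin-twinSum n v end α = trans (X-as-sum (twin (path (suc n)) v) α)
    (trans (W.∑-colorings (suc n) _ α) (Σ.∑-cong (allFin N) (side (isEndVertex⇒extreme n v end)) α))
    where
    κs = colorings N (suc n)
    side : v ≡ zero ⊎ opposite v ≡ zero → ∀ a →
      ∑ˢ κs (λ κ → mul N (W.⟦ does (proper? (twin (path (suc n)) v) (a ∷ κ)) ⟧) (W.monomial (a ∷ κ)))
        ≈ˢ ∑ˢ κs (λ κ → mul N (W.⟦ isTwinColoring a κ ⟧) (W.monomial (a ∷ κ)))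
    side (inj₁ refl) a = Σ.∑-cong κs (λ κ → R.*-congʳ (R.reflexive (cong W.⟦_⟧ (does-proper-twin a κ))))
    side (inj₂ v≡)   a = R.trans
      (Σ.∑-cong κs (λ κ → R.*-cong (R.reflexive (cong W.⟦_⟧ (reversed κ)))
                                   (R.*-congˡ {var a} (R.sym {W.monomial (reverse κ)} (W.monomial-reverse κ)))))
      (W.∑-colorings-reverse (suc n) (λ κ → mul N (W.⟦ isTwinColoring a κ ⟧) (W.monomial (a ∷ κ))))
      where
      reversed : ∀ κ → does (proper? (twin (path (suc n)) v) (a ∷ κ)) ≡ isTwinColoring a (reverse κ)
      reversed κ = trans (does-proper-twin-reverse v a κ)
        (trans (cong (λ u → does (proper? (twin (path (suc n)) u) (a ∷ reverse κ))) v≡) (does-proper-twin a (reverse κ)))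

  ×-eval : ∀ k (f : Series[ N ]) α → (k M.× f) α ≡ + k ℤ.* f α
  ×-eval zero    f α = refl
  ×-eval (suc k) f α = trans (cong (ℤ._+_ (f α)) (×-eval k f α)) (sym (ℤ.suc-* (+ k) (f α)))

  pathSum-recurrence : W.pathSum S.≋ (λ k α → elementary α k) S.⊞ (λ k → (k ∸ 1) M.× (λ α → elementary α k)) S.✶ W.pathSum
  pathSum-recurrence = Transfer.chromatic-recurrence (ringˢ N) (allFin N) var
    W.pathSum (λ k α → elementary α k) W.pathSumFrom (λ i k α → elementaryThrough i α k)
    W.pathSum-zero elementary-0 W.pathSum-suc (λ i α → refl) W.pathSumFrom-suc
    elementaryThrough-0 (λ i k α → elementaryThrough-suc i α k)
    (λ k α → trans (∑ˢ-eval (allFin N) (λ i β → elementaryThrough i β k) α)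
                   (trans (∑-elementaryThrough α k) (sym (×-eval k (λ β → elementary β k) α))))
    where
    elementary-0 : (λ α → elementary α 0) ≈ˢ one N
    elementary-0 α = go N α
      where
      go : ∀ N α → elementary α 0 ≡ one N α
      go zero    []                = refl
      go (suc N) (zero        ∷ α) = go N α
      go (suc N) (suc zero    ∷ α) = refl
      go (suc N) (suc (suc _) ∷ α) = refl

  -- The summands at i = 0 and i = 1 carry the factor 0, the former by truncated subtraction; with
  -- them the sum is a plain convolution.
  path-recurrence : ∀ n α → XP n N α ≡
    e n N α ℤ.+ ℤ∑.∑ (upTo (suc n)) (λ i → + (i ∸ 1) ℤ.* (e i ⊗ XP (n ∸ i)) N α)
  path-recurrence n α = begin
    XP n N α
      ≡⟨ XP-pathSum n α ⟩
    W.pathSum n α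
      ≡⟨ pathSum-recurrence n α ⟩
    elementary α n ℤ.+ ((λ k → (k ∸ 1) M.× ε k) S.✶ W.pathSum) n α
      ≡⟨ cong₂ ℤ._+_ (sym (e-elementary n N α)) (trans (Σ.✶-as-∑ _ W.pathSum n α) (∑ˢ-eval (upTo (suc n)) (λ i → mul N ((i ∸ 1) M.× ε i) (W.pathSum (n ∸ i))) α)) ⟩
    e n N α ℤ.+ ℤ∑.∑ (upTo (suc n)) (λ i → mul N ((i ∸ 1) M.× ε i) (W.pathSum (n ∸ i)) α)
      ≡⟨ cong (ℤ._+_ (e n N α)) (ℤ∑.∑-cong (upTo (suc n)) term) ⟩
    e n N α ℤ.+ ℤ∑.∑ (upTo (suc n)) (λ i → + (i ∸ 1) ℤ.* (e i ⊗ XP (n ∸ i)) N α) ∎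
    where
    open ≡-Reasoning
    ε : ℕ → Series[ N ]
    ε k α = elementary α k
    term : ∀ i → mul N ((i ∸ 1) M.× ε i) (W.pathSum (n ∸ i)) α ≡ + (i ∸ 1) ℤ.* (e i ⊗ XP (n ∸ i)) N α
    term i = begin
      mul N ((i ∸ 1) M.× ε i) (W.pathSum (n ∸ i)) α      ≡⟨ M.×-assoc-* (i ∸ 1) (ε i) (W.pathSum (n ∸ i)) α ⟩
      ((i ∸ 1) M.× mul N (ε i) (W.pathSum (n ∸ i))) α    ≡⟨ ×-eval (i ∸ 1) _ α ⟩
      + (i ∸ 1) ℤ.* mul N (ε i) (W.pathSum (n ∸ i)) α
        ≡⟨ cong (ℤ._*_ (+ (i ∸ 1))) (R.*-cong {e i N} {ε i} {XP (n ∸ i) N} (e-elementary i N) (XP-pathSum (n ∸ i)) α) ⟨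
      + (i ∸ 1) ℤ.* mul N (e i N) (XP (n ∸ i) N) α       ≡⟨ cong (ℤ._*_ (+ (i ∸ 1))) (⊗-mul (e i) (XP (n ∸ i)) N α) ⟨
      + (i ∸ 1) ℤ.* (e i ⊗ XP (n ∸ i)) N α ∎

  twin-path : ∀ n (v : Fin (suc n)) → IsEndVertex (suc n) v → ∀ α →
    X (twin (path (suc n)) v) N α ℤ.+ (XP 2 ⊗ XP n) N α ≡ XP (suc (suc n)) N α ℤ.+ XP (suc (suc n)) N α
  twin-path n v end α = begin
    X (twin (path (suc n)) v) N α ℤ.+ (XP 2 ⊗ XP n) N α
      ≡⟨ cong₂ ℤ._+_ (twin-twinSum n v end α)
           (trans (⊗-mul (XP 2) (XP n) N α) (R.*-cong {XP 2 N} {W.pathSum 2} {XP n N} (XP-pathSum 2) (XP-pathSum n) α)) ⟩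
    W.twinSum n α ℤ.+ mul N (W.pathSum 2) (W.pathSum n) α
      ≡⟨ W.twin-deletion n α ⟩
    W.pathSum (suc (suc n)) α ℤ.+ W.pathSum (suc (suc n)) α
      ≡⟨ cong₂ ℤ._+_ (XP-pathSum (suc (suc n)) α) (XP-pathSum (suc (suc n)) α) ⟨
    XP (suc (suc n)) N α ℤ.+ XP (suc (suc n)) N α ∎
    where open ≡-Reasoning

open +-*-Solver using (solve; _:+_; _:*_; _:=_; con)

-- Ring laws for formal power series

⊗-cong : ∀ {F F′ G G′} → F ≈ F′ → G ≈ G′ → F ⊗ G ≈ F′ ⊗ G′
⊗-cong {F} {F′} {G} {G′} p q N α =
  trans (⊗-mul F G N α) (trans (CommutativeRing.*-cong (ringˢ N) {F N} {F′ N} {G N} (p N) (q N) α) (sym (⊗-mul F′ G′ N α)))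

⊗-congˡ : ∀ F {G G′} → G ≈ G′ → F ⊗ G ≈ F ⊗ G′
⊗-congˡ F {G} = ⊗-cong {F} {F} {G} (λ N α → refl)

⊗-congʳ : ∀ {F F′} G → F ≈ F′ → F ⊗ G ≈ F′ ⊗ G
⊗-congʳ {F} G p = ⊗-cong {F} {G = G} p (λ N α → refl)

⊗-comm : ∀ F G → F ⊗ G ≈ G ⊗ F
⊗-comm F G N α =
  trans (⊗-mul F G N α) (trans (CommutativeRing.*-comm (ringˢ N) (F N) (G N) α) (sym (⊗-mul G F N α)))

⊗-assoc : ∀ F G H → (F ⊗ G) ⊗ H ≈ F ⊗ (G ⊗ H)
⊗-assoc F G H N α = begin
  ((F ⊗ G) ⊗ H) N α                    ≡⟨ ⊗-mul (F ⊗ G) H N α ⟩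
  mul N ((F ⊗ G) N) (H N) α            ≡⟨ R.*-congʳ {H N} {(F ⊗ G) N} (⊗-mul F G N) α ⟩
  mul N (mul N (F N) (G N)) (H N) α    ≡⟨ R.*-assoc (F N) (G N) (H N) α ⟩
  mul N (F N) (mul N (G N) (H N)) α    ≡⟨ R.*-congˡ {F N} {(G ⊗ H) N} (⊗-mul G H N) α ⟨
  mul N (F N) ((G ⊗ H) N) α            ≡⟨ ⊗-mul F (G ⊗ H) N α ⟨
  (F ⊗ (G ⊗ H)) N α                    ∎
  where
  open ≡-Reasoning
  module R = CommutativeRing (ringˢ N)

⊗-leftComm : ∀ F G H → F ⊗ (G ⊗ H) ≈ G ⊗ (F ⊗ H)
⊗-leftComm F G H N α = trans (sym (⊗-assoc F G H N α))
  (trans (⊗-congʳ H (⊗-comm F G) N α) (⊗-assoc G F H N α))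

⊗-identityʳ : ∀ F → F ⊗ 𝟙 ≈ F
⊗-identityʳ F N α = trans (⊗-mul F 𝟙 N α)
  (trans (R.*-congˡ {F N} {𝟙 N} (𝟙-one N) α) (R.*-identityʳ (F N) α))
  where module R = CommutativeRing (ringˢ N)

⊗-𝟘 : ∀ F → F ⊗ 𝟘 ≈ 𝟘
⊗-𝟘 F N α = trans (⊗-mul F 𝟘 N α) (mul-zeroʳ (F N) α)

⊗-⊕ : ∀ F G H → F ⊗ (G ⊕ H) ≈ F ⊗ G ⊕ F ⊗ H
⊗-⊕ F G H N α = trans (⊗-mul F (G ⊕ H) N α)
  (trans (CommutativeRing.distribˡ (ringˢ N) (F N) (G N) (H N) α)
    (cong₂ ℤ._+_ (sym (⊗-mul F G N α)) (sym (⊗-mul F H N α))))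

⊙-⊗ : ∀ c F G → (c ⊙ F) ⊗ G ≈ c ⊙ (F ⊗ G)
⊙-⊗ c F G N α = begin
  ((c ⊙ F) ⊗ G) N α
    ≡⟨ ⊗-as-∑ (c ⊙ F) G N α ⟩
  ℤ∑.∑ (splits α) (λ s → c ℤ.* F N (proj₁ s) ℤ.* G N (proj₂ s))
    ≡⟨ ℤ∑.∑-cong (splits α) (λ s → ℤ.*-assoc c _ _) ⟩
  ℤ∑.∑ (splits α) (λ s → c ℤ.* (F N (proj₁ s) ℤ.* G N (proj₂ s)))
    ≡⟨ ℤ∑.*-∑ (splits α) c _ ⟩
  c ℤ.* ℤ∑.∑ (splits α) (λ s → F N (proj₁ s) ℤ.* G N (proj₂ s))
    ≡⟨ cong (ℤ._*_ c) (⊗-as-∑ F G N α) ⟨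
  c ℤ.* (F ⊗ G) N α ∎
  where open ≡-Reasoning

⊗-⊙ : ∀ c F G → F ⊗ (c ⊙ G) ≈ c ⊙ (F ⊗ G)
⊗-⊙ c F G N α = trans (⊗-comm F (c ⊙ G) N α)
  (trans (⊙-⊗ c G F N α) (cong (ℤ._*_ c) (⊗-comm G F N α)))

∑ᴾ : {I : Set} → List I → (I → PowerSeries) → PowerSeries
∑ᴾ is F N α = ℤ∑.∑ is (λ i → F i N α)

⊗-∑ᴾ : ∀ {I : Set} (is : List I) F (G : I → PowerSeries) → F ⊗ ∑ᴾ is G ≈ ∑ᴾ is (λ i → F ⊗ G i)
⊗-∑ᴾ []       F G N α = ⊗-𝟘 F N α
⊗-∑ᴾ (i ∷ is) F G N α = trans (⊗-⊕ F (G i) (∑ᴾ is G) N α) (cong (ℤ._+_ ((F ⊗ G i) N α)) (⊗-∑ᴾ is F G N α))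

-- e-positivity

IsETerm : ℤ × List ℕ → Set
IsETerm (c , μ) = 0ℤ ℤ.≤ c × All (_> 0) μ

-- Unlike in EPositive, parts may come in any order and terms may repeat.
ECombinable : PowerSeries → Set
ECombinable F = Σ[ ts ∈ List (ℤ × List ℕ) ] All IsETerm ts × F ≈ e-combination ts

ECombinable-≈ : ∀ {F G} → F ≈ G → ECombinable G → ECombinable F
ECombinable-≈ p (ts , ok , eq) = ts , ok , λ N α → trans (p N α) (eq N α)

ECombinable-𝟘 : ECombinable 𝟘
ECombinable-𝟘 = [] , [] , λ N α → refl

ECombinable-𝟙 : ECombinable 𝟙
ECombinable-𝟙 = (1ℤ , []) ∷ [] , (ℤ.+≤+ ℕ.z≤n , []) ∷ [] ,
  λ N α → sym (trans (ℤ.+-identityʳ _) (ℤ.*-identityˡ _))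

ECombinable-⊕ : ∀ {F G} → ECombinable F → ECombinable G → ECombinable (F ⊕ G)
ECombinable-⊕ (ts , okt , eqt) (us , oku , equ) = ts ++ us , All.++⁺ okt oku ,
  λ N α → trans (cong₂ ℤ._+_ (eqt N α) (equ N α)) (sym (e-combination-++ ts us N α))
  where
  e-combination-++ : ∀ ts us → e-combination (ts ++ us) ≈ e-combination ts ⊕ e-combination us
  e-combination-++ []             us N α = sym (ℤ.+-identityˡ _)
  e-combination-++ ((c , μ) ∷ ts) us N α =
    trans (cong (ℤ._+_ (c ℤ.* e-product μ N α)) (e-combination-++ ts us N α)) (sym (ℤ.+-assoc (c ℤ.* e-product μ N α) _ _))

ECombinable-⊙ : ∀ n {F} → ECombinable F → ECombinable ((+ n) ⊙ F)
ECombinable-⊙ n (ts , ok , eq) = map scale ts , All.map⁺ (All.map (λ {t} → scaled t) ok) ,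
  λ N α → trans (cong (ℤ._*_ (+ n)) (eq N α)) (sym (e-combination-scale ts N α))
  where
  scale : ℤ × List ℕ → ℤ × List ℕ
  scale (c , μ) = + n ℤ.* c , μ
  scaled : ∀ t → IsETerm t → IsETerm (scale t)
  scaled (c , μ) (0≤c , pos) = subst (ℤ._≤ + n ℤ.* c) (ℤ.*-zeroʳ (+ n)) (ℤ.*-monoˡ-≤-nonNeg (+ n) 0≤c) , pos
  e-combination-scale : ∀ ts → e-combination (map scale ts) ≈ (+ n) ⊙ e-combination ts
  e-combination-scale []             N α = sym (ℤ.*-zeroʳ (+ n))
  e-combination-scale ((c , μ) ∷ ts) N α = trans
    (cong₂ ℤ._+_ (ℤ.*-assoc (+ n) c _) (e-combination-scale ts N α)) (sym (ℤ.*-distribˡ-+ (+ n) _ _))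

ECombinable-e⊗ : ∀ k {F} → ECombinable F → ECombinable (e (suc k) ⊗ F)
ECombinable-e⊗ k {F} (ts , ok , eq) = map extend ts , All.map⁺ (All.map (λ { (0≤c , pos) → 0≤c , ℕ.s≤s ℕ.z≤n ∷ pos }) ok) ,
  λ N α → trans (⊗-congˡ (e (suc k)) eq N α) (sym (e-combination-extend ts N α))
  where
  extend : ℤ × List ℕ → ℤ × List ℕ
  extend (c , μ) = c , suc k ∷ μ
  e-combination-extend : ∀ ts → e-combination (map extend ts) ≈ e (suc k) ⊗ e-combination ts
  e-combination-extend []             N α = sym (⊗-𝟘 (e (suc k)) N α)
  e-combination-extend ((c , μ) ∷ ts) N α = trans
    (cong₂ ℤ._+_ (sym (⊗-⊙ c (e (suc k)) (e-product μ) N α)) (e-combination-extend ts N α))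
    (sym (⊗-⊕ (e (suc k)) (c ⊙ e-product μ) (e-combination ts) N α))

ECombinable-e : ∀ k → ECombinable (e (suc k))
ECombinable-e k = ECombinable-≈ (λ N α → sym (⊗-identityʳ (e (suc k)) N α)) (ECombinable-e⊗ k ECombinable-𝟙)

ECombinable-∑ : ∀ {I : Set} (is : List I) {F : I → PowerSeries} → (∀ i → ECombinable (F i)) → ECombinable (∑ᴾ is F)
ECombinable-∑ []       p = ECombinable-𝟘
ECombinable-∑ (i ∷ is) p = ECombinable-⊕ (p i) (ECombinable-∑ is p)

e-product-↭ : ∀ {μ ν} → μ ↭ ν → e-product μ ≈ e-product ν
e-product-↭ _↭_.refl N α = refl
e-product-↭ (_↭_.prep k p) N α = ⊗-congˡ (e k) (e-product-↭ p) N α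
e-product-↭ {_ ∷ _ ∷ μ} {_ ∷ _ ∷ ν} (_↭_.swap k l p) N α =
  trans (⊗-leftComm (e k) (e l) (e-product μ) N α) (⊗-congˡ (e l) (⊗-congˡ (e k) (e-product-↭ p)) N α)
e-product-↭ (_↭_.trans p q) N α = trans (e-product-↭ p N α) (e-product-↭ q N α)

-- Sorting for the reversed order yields the weakly decreasing lists demanded by `IsPartition`.
open Sort (Flip.decTotalOrder ℕ.≤-decTotalOrder) using (sort; sort-↭; sort-↗)

-- A coefficient of a partition that is already listed is added to its entry. This keeps the
-- partitions distinct, and nonnegative coefficients stay nonnegative.
addTerm : ℤ → List ℕ → List (ℤ × List ℕ) → List (ℤ × List ℕ)
addTerm c μ []             = (c , μ) ∷ []
addTerm c μ ((d , ν) ∷ ts) with List.≡-dec ℕ._≟_ μ ν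
... | yes _ = (c ℤ.+ d , ν) ∷ ts
... | no  _ = (d , ν) ∷ addTerm c μ ts

collect : List (ℤ × List ℕ) → List (ℤ × List ℕ)
collect []             = []
collect ((c , μ) ∷ ts) = addTerm c (sort μ) (collect ts)

All-addTerm : ∀ {P : List ℕ → Set} c {μ} ts → P μ → All P (map proj₂ ts) → All P (map proj₂ (addTerm c μ ts))
All-addTerm c     []             p []        = p ∷ []
All-addTerm c {μ} ((d , ν) ∷ ts) p (q ∷ qs) with List.≡-dec ℕ._≟_ μ ν
... | yes _ = q ∷ qs
... | no  _ = q ∷ All-addTerm c ts p qs

addTerm-unique : ∀ c μ ts → Unique (map proj₂ ts) → Unique (map proj₂ (addTerm c μ ts))
addTerm-unique c μ []             u = [] ∷ []
addTerm-unique c μ ((d , ν) ∷ ts) (ν∉ ∷ u) with List.≡-dec ℕ._≟_ μ ν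
... | yes _   = ν∉ ∷ u
... | no  μ≢ν = All-addTerm c ts (λ ν≡μ → μ≢ν (sym ν≡μ)) ν∉ ∷ addTerm-unique c μ ts u

addTerm-nonNeg : ∀ {c} μ ts → 0ℤ ℤ.≤ c → All (ℤ._≤_ 0ℤ) (map proj₁ ts) → All (ℤ._≤_ 0ℤ) (map proj₁ (addTerm c μ ts))
addTerm-nonNeg μ []             p []        = p ∷ []
addTerm-nonNeg μ ((d , ν) ∷ ts) p (q ∷ qs) with List.≡-dec ℕ._≟_ μ ν
... | yes _ = ℤ.+-mono-≤ p q ∷ qs
... | no  _ = q ∷ addTerm-nonNeg μ ts p qs

e-combination-addTerm : ∀ c μ ts → e-combination (addTerm c μ ts) ≈ c ⊙ e-product μ ⊕ e-combination ts
e-combination-addTerm c μ []             N α = refl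
e-combination-addTerm c μ ((d , ν) ∷ ts) N α with List.≡-dec ℕ._≟_ μ ν
... | yes refl = solve 4 (λ c d x y → (c :+ d) :* x :+ y := c :* x :+ (d :* x :+ y)) refl c d _ _
... | no  _    = trans (cong (ℤ._+_ (d ℤ.* e-product ν N α)) (e-combination-addTerm c μ ts N α))
  (solve 3 (λ x y z → x :+ (y :+ z) := y :+ (x :+ z)) refl
    (d ℤ.* e-product ν N α) (c ℤ.* e-product μ N α) (e-combination ts N α))

e-combination-collect : ∀ ts → e-combination ts ≈ e-combination (collect ts)
e-combination-collect []             N α = refl
e-combination-collect ((c , μ) ∷ ts) N α = trans
  (cong₂ (λ x y → c ℤ.* x ℤ.+ y) (e-product-↭ (↭-sym (sort-↭ μ)) N α) (e-combination-collect ts N α))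
  (sym (e-combination-addTerm c (sort μ) (collect ts) N α))

ECombinable⇒EPositive : ∀ {F} → ECombinable F → EPositive F
ECombinable⇒EPositive (ts , ok , eq) = record
  { terms      = collect ts
  ; partitions = partitions ts ok
  ; distinct   = distinct ts
  ; expansion  = λ N α → trans (eq N α) (e-combination-collect ts N α)
  } , nonNeg ts ok
  where
  partitions : ∀ ts → All IsETerm ts → All IsPartition (map proj₂ (collect ts))
  partitions []             []              = []
  partitions ((c , μ) ∷ ts) ((_ , pos) ∷ ok) =
    All-addTerm c (collect ts) (sort-↗ μ , All-resp-↭ (↭-sym (sort-↭ μ)) pos) (partitions ts ok)
  distinct : ∀ ts → Unique (map proj₂ (collect ts))
  distinct []             = []
  distinct ((c , μ) ∷ ts) = addTerm-unique c (sort μ) (collect ts) (distinct ts)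
  nonNeg : ∀ ts → All IsETerm ts → All (ℤ._≤_ 0ℤ) (map proj₁ (collect ts))
  nonNeg []             []              = []
  nonNeg ((c , μ) ∷ ts) ((0≤c , _) ∷ ok) = addTerm-nonNeg (sort μ) (collect ts) 0≤c (nonNeg ts ok)

open import Algebra.Properties.Ring ℤ.+-*-ring using (+-cancelʳ)
open import Data.Integer using (_*_; _-_)
open import Data.Nat using (_+_; _≤_)

-- Chromatic symmetric functions of paths

XP-0 : XP 0 ≈ 𝟙
XP-0 N α = trans (XP-pathSum N 0 α) (trans (pathSum-zero α) (sym (𝟙-one N α)))
  where open Words (ringˢ N) N var using (pathSum-zero)

⊗-XP-0 : ∀ F → F ⊗ XP 0 ≈ F
⊗-XP-0 F N α = trans (⊗-congˡ F XP-0 N α) (⊗-identityʳ F N α)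

XP-1 : XP 1 ≈ e 1
XP-1 N α = trans (path-recurrence N 1 α) (ℤ.+-identityʳ _)

-- The two vanishing summands are dropped. With j = 2 + i the factor j - 1 is the natural number 1 +
-- i, free of truncated subtraction.
XP-recurrence : ∀ m → XP (2 + m) ≈ e (2 + m) ⊕ ∑ᴾ (upTo (suc m)) (λ i → (+ (1 + i)) ⊙ (e (2 + i) ⊗ XP (m ∸ i)))
XP-recurrence m N α = trans (path-recurrence N (2 + m) α) (cong (ℤ._+_ (e (2 + m) N α)) (begin
  ∑ᴾ (upTo (3 + m)) f N α
    ≡⟨ ℤ∑.∑-upTo-suc (2 + m) (λ i → f i N α) ⟩
  0ℤ ℤ.+ ∑ᴾ (upTo (2 + m)) (λ i → f (1 + i)) N α
    ≡⟨ trans (ℤ.+-identityˡ _) (ℤ∑.∑-upTo-suc (1 + m) (λ i → f (1 + i) N α)) ⟩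
  0ℤ ℤ.+ ∑ᴾ (upTo (1 + m)) (λ i → f (2 + i)) N α
    ≡⟨ ℤ.+-identityˡ _ ⟩
  ∑ᴾ (upTo (1 + m)) (λ i → f (2 + i)) N α ∎))
  where
  open ≡-Reasoning
  f : ℕ → PowerSeries
  f i = (+ (i ∸ 1)) ⊙ (e i ⊗ XP (2 + m ∸ i))

XP-2 : XP 2 ≈ (+ 2) ⊙ e 2
XP-2 N α = trans (XP-recurrence 0 N α)
  (trans (cong (λ y → e 2 N α ℤ.+ (1ℤ * y ℤ.+ 0ℤ)) (⊗-XP-0 (e 2) N α))
    (solve 1 (λ x → x :+ (con 1ℤ :* x :+ con 0ℤ) := con (+ 2) :* x) refl (e 2 N α)))

XP-ECombinable : ∀ n → ECombinable (XP n)
XP-ECombinable n = go n n ℕ.≤-refl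
  where
  -- The index `m ∸ i` is not structurally smaller than n, so the recursion runs on the bound `b`.
  go : ∀ b n → n ≤ b → ECombinable (XP n)
  go b       zero          _ = ECombinable-≈ XP-0 ECombinable-𝟙
  go b       (suc zero)    _ = ECombinable-≈ XP-1 (ECombinable-e 0)
  go (suc b) (suc (suc m)) (ℕ.s≤s m<b) = ECombinable-≈ (XP-recurrence m)
    (ECombinable-⊕ (ECombinable-e (suc m)) (ECombinable-∑ (upTo (suc m)) λ i →
      ECombinable-⊙ (1 + i) (ECombinable-e⊗ (1 + i)
        (go b (m ∸ i) (ℕ.≤-trans (ℕ.m∸n≤m m i) (ℕ.<⇒≤ m<b))))))

-- Twinned paths

-- The correction term stands on the left so that no subtraction occurs.
twin-relation : ∀ n (v : Fin (suc n)) → IsEndVertex (suc n) v →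
  X (twin (path (suc n)) v) ⊕ (+ 2) ⊙ (e 2 ⊗ XP n) ≈ (+ 2) ⊙ XP (2 + n)
twin-relation n v end N α = begin
  X (twin (path (suc n)) v) N α ℤ.+ + 2 * (e 2 ⊗ XP n) N α
    ≡⟨ cong (ℤ._+_ (X (twin (path (suc n)) v) N α)) (trans (⊗-congʳ (XP n) XP-2 N α) (⊙-⊗ (+ 2) (e 2) (XP n) N α)) ⟨
  X (twin (path (suc n)) v) N α ℤ.+ (XP 2 ⊗ XP n) N α
    ≡⟨ twin-path N n v end α ⟩
  XP (2 + n) N α ℤ.+ XP (2 + n) N α
    ≡⟨ solve 1 (λ x → x :+ x := con (+ 2) :* x) refl (XP (2 + n) N α) ⟩
  + 2 * XP (2 + n) N α ∎
  where open ≡-Reasoning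

twin-1 : (v : Fin 1) → IsEndVertex 1 v → X (twin (path 1) v) ≈ (+ 2) ⊙ e 2
twin-1 v end N α = +-cancelʳ (+ 2 * e 2 N α) _ _ (begin
  X (twin (path 1) v) N α ℤ.+ + 2 * e 2 N α
    ≡⟨ cong (λ y → X (twin (path 1) v) N α ℤ.+ + 2 * y) (⊗-XP-0 (e 2) N α) ⟨
  X (twin (path 1) v) N α ℤ.+ + 2 * (e 2 ⊗ XP 0) N α
    ≡⟨ twin-relation 0 v end N α ⟩
  + 2 * XP 2 N α
    ≡⟨ cong (_*_ (+ 2)) (XP-2 N α) ⟩
  + 2 * (+ 2 * e 2 N α)
    ≡⟨ solve 1 (λ x → con (+ 2) :* (con (+ 2) :* x) := con (+ 2) :* x :+ con (+ 2) :* x) refl (e 2 N α) ⟩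
  + 2 * e 2 N α ℤ.+ + 2 * e 2 N α ∎)
  where open ≡-Reasoning

-- The last summand is (1 + m) e_{2+m} X(P_0) with X(P_0) = 1, and it merges with the free term
-- e_{2+m}.
XP-recurrence-last : ∀ m → XP (2 + m) ≈
  (+ (2 + m)) ⊙ e (2 + m) ⊕ ∑ᴾ (upTo m) (λ i → (+ (1 + i)) ⊙ (e (2 + i) ⊗ XP (m ∸ i)))
XP-recurrence-last m N α = begin
  XP (2 + m) N α
    ≡⟨ XP-recurrence m N α ⟩
  ε ℤ.+ ∑ᴾ (upTo (suc m)) f N α
    ≡⟨ cong (ℤ._+_ ε) (ℤ∑.∑-upTo-last m (λ i → f i N α)) ⟩
  ε ℤ.+ (∑ᴾ (upTo m) f N α ℤ.+ + (1 + m) * (e (2 + m) ⊗ XP (m ∸ m)) N α)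
    ≡⟨ cong (λ y → ε ℤ.+ (∑ᴾ (upTo m) f N α ℤ.+ + (1 + m) * y))
         (trans (cong (λ k → (e (2 + m) ⊗ XP k) N α) (ℕ.n∸n≡0 m)) (⊗-XP-0 (e (2 + m)) N α)) ⟩
  ε ℤ.+ (∑ᴾ (upTo m) f N α ℤ.+ + (1 + m) * ε)
    ≡⟨ solve 3 (λ x s c → x :+ (s :+ (con 1ℤ :+ c) :* x) := (con (+ 2) :+ c) :* x :+ s) refl ε (∑ᴾ (upTo m) f N α) (+ m) ⟩
  + (2 + m) * ε ℤ.+ ∑ᴾ (upTo m) f N α ∎
  where
  open ≡-Reasoning
  ε = e (2 + m) N α
  f : ℕ → PowerSeries
  f i = (+ (1 + i)) ⊙ (e (2 + i) ⊗ XP (m ∸ i))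

-- The summand j = 2 of the path recurrence, doubled, is the correction term of `twin-relation`,
-- here `+ 2 * y`, and cancels. The formula holds for every path on at least two vertices, so it
-- also yields the initial values for n = 2 and n = 3.
twin-formula : ∀ m (v : Fin (2 + m)) → IsEndVertex (2 + m) v → X (twin (path (2 + m)) v) ≈
  (+ 2 * + (3 + m)) ⊙ e (3 + m) ⊕ (+ 2) ⊙ ∑ᴾ (upTo m) (λ i → (+ (2 + i)) ⊙ (e (3 + i) ⊗ XP (m ∸ i)))
twin-formula m v end N α = +-cancelʳ (+ 2 * y) _ _ (begin
  X (twin (path (2 + m)) v) N α ℤ.+ + 2 * y
    ≡⟨ twin-relation (1 + m) v end N α ⟩
  + 2 * XP (3 + m) N α
    ≡⟨ cong (_*_ (+ 2)) (trans (XP-recurrence-last (1 + m) N α)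
         (cong (ℤ._+_ (+ (3 + m) * x)) (ℤ∑.∑-upTo-suc m (λ i → f i N α)))) ⟩
  + 2 * (+ (3 + m) * x ℤ.+ (1ℤ * y ℤ.+ s))
    ≡⟨ solve 4 (λ c x y s → con (+ 2) :* (c :* x :+ (con 1ℤ :* y :+ s)) := con (+ 2) :* c :* x :+ con (+ 2) :* s :+ con (+ 2) :* y)
         refl (+ (3 + m)) x y s ⟩
  + 2 * + (3 + m) * x ℤ.+ + 2 * s ℤ.+ + 2 * y ∎)
  where
  open ≡-Reasoning
  f : ℕ → PowerSeries
  f i = (+ (1 + i)) ⊙ (e (2 + i) ⊗ XP (1 + m ∸ i))
  x = e (3 + m) N α
  y = (e 2 ⊗ XP (1 + m)) N α
  s = ∑ᴾ (upTo m) (λ i → f (1 + i)) N α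

-- With n = 4 + m, the summands j = n - 1 and j = n of X(P_{n+1}) are separated, using X(P_2) = 2
-- e_2 and X(P_1) = e_1. The remaining sum has the range 2, ..., n - 2 of the recurrence for twins.
XP-top-terms : ∀ m → XP (5 + m) ≈ (+ (5 + m)) ⊙ e (5 + m) ⊕
  (∑ᴾ (upTo (1 + m)) (λ i → (+ (1 + i)) ⊙ (e (2 + i) ⊗ XP (3 + m ∸ i)))
    ⊕ (+ (2 + m)) ⊙ ((+ 2) ⊙ (e (3 + m) ⊗ e 2)) ⊕ (+ (3 + m)) ⊙ (e (4 + m) ⊗ e 1))
XP-top-terms m N α = trans (XP-recurrence-last (3 + m) N α) (cong (ℤ._+_ (+ (5 + m) * e (5 + m) N α)) (begin
  ∑ᴾ (upTo (3 + m)) g N α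
    ≡⟨ ℤ∑.∑-upTo-last (2 + m) (λ i → g i N α) ⟩
  ∑ᴾ (upTo (2 + m)) g N α ℤ.+ g (2 + m) N α
    ≡⟨ cong (ℤ._+ g (2 + m) N α) (ℤ∑.∑-upTo-last (1 + m) (λ i → g i N α)) ⟩
  ∑ᴾ (upTo (1 + m)) g N α ℤ.+ g (1 + m) N α ℤ.+ g (2 + m) N α
    ≡⟨ cong₂ (λ a b → ∑ᴾ (upTo (1 + m)) g N α ℤ.+ + (2 + m) * a ℤ.+ + (3 + m) * b)
         (trans (cong (λ k → (e (3 + m) ⊗ XP k) N α) (ℕ.m+n∸n≡m 2 m))
           (trans (⊗-congˡ (e (3 + m)) XP-2 N α) (⊗-⊙ (+ 2) (e (3 + m)) (e 2) N α)))
         (trans (cong (λ k → (e (4 + m) ⊗ XP k) N α) (ℕ.m+n∸n≡m 1 m)) (⊗-congˡ (e (4 + m)) XP-1 N α)) ⟩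
  (∑ᴾ (upTo (1 + m)) g ⊕ (+ (2 + m)) ⊙ ((+ 2) ⊙ (e (3 + m) ⊗ e 2)) ⊕ (+ (3 + m)) ⊙ (e (4 + m) ⊗ e 1)) N α ∎))
  where
  open ≡-Reasoning
  g : ℕ → PowerSeries
  g i = (+ (1 + i)) ⊙ (e (2 + i) ⊗ XP (3 + m ∸ i))

-- Expands the correction term of the longest twinned path, so that its summands pair with the
-- correction terms of the shorter ones.
e₂⊗XP : ∀ m → e 2 ⊗ XP (2 + m) ≈
  (+ (2 + m)) ⊙ (e (2 + m) ⊗ e 2) ⊕ ∑ᴾ (upTo m) (λ i → e 2 ⊗ ((+ (1 + i)) ⊙ (e (2 + i) ⊗ XP (m ∸ i))))
e₂⊗XP m N α = begin
  (e 2 ⊗ XP (2 + m)) N α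
    ≡⟨ ⊗-congˡ (e 2) (XP-recurrence-last m) N α ⟩
  (e 2 ⊗ ((+ (2 + m)) ⊙ e (2 + m) ⊕ ∑ᴾ (upTo m) g)) N α
    ≡⟨ ⊗-⊕ (e 2) ((+ (2 + m)) ⊙ e (2 + m)) (∑ᴾ (upTo m) g) N α ⟩
  (e 2 ⊗ ((+ (2 + m)) ⊙ e (2 + m))) N α ℤ.+ (e 2 ⊗ ∑ᴾ (upTo m) g) N α
    ≡⟨ cong₂ ℤ._+_
         (trans (⊗-⊙ (+ (2 + m)) (e 2) (e (2 + m)) N α) (cong (_*_ (+ (2 + m))) (⊗-comm (e 2) (e (2 + m)) N α)))
         (⊗-∑ᴾ (upTo m) (e 2) g N α) ⟩
  ((+ (2 + m)) ⊙ (e (2 + m) ⊗ e 2) ⊕ ∑ᴾ (upTo m) (λ i → e 2 ⊗ g i)) N α ∎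
  where
  open ≡-Reasoning
  g : ℕ → PowerSeries
  g i = (+ (1 + i)) ⊙ (e (2 + i) ⊗ XP (m ∸ i))

-- The subscripts are those of the case n = 4, and in general n = 4 + m: `a` is X(P_{n,v}), `x₅` is
-- X(P_{n+1}) and `x₃` is e_2 X(P_{n-1}). The sums `sA`, `sE`, `sX` collect the twins, their
-- corrections and the paths. For `e₃e₂` the coefficients combine to 4 (2 + m) - 2 (3 + m) = 2 (1 +
-- m).
recurrence-from-relations : ∀ (m a x₅ x₃ e₅ e₄e₁ e₃e₂ sA sE sX : ℤ) →
  a ℤ.+ + 2 * x₃ ≡ + 2 * x₅ →
  x₅ ≡ (+ 5 ℤ.+ m) * e₅ ℤ.+ (sX ℤ.+ (+ 2 ℤ.+ m) * (+ 2 * e₃e₂) ℤ.+ (+ 3 ℤ.+ m) * e₄e₁) →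
  x₃ ≡ (+ 3 ℤ.+ m) * e₃e₂ ℤ.+ sE →
  sA ℤ.+ + 2 * sE ≡ + 2 * sX →
  a ≡ sA ℤ.+ (+ 2 * (+ 5 ℤ.+ m) * e₅ ℤ.+ + 2 * (+ 3 ℤ.+ m) * e₄e₁ ℤ.+ + 2 * (+ 1 ℤ.+ m) * e₃e₂)
recurrence-from-relations m a x₅ x₃ e₅ e₄e₁ e₃e₂ sA sE sX a-eq refl refl s-eq = +-cancelʳ (+ 2 * ((+ 3 ℤ.+ m) * e₃e₂ ℤ.+ sE)) _ _ (begin
  a ℤ.+ + 2 * ((+ 3 ℤ.+ m) * e₃e₂ ℤ.+ sE)
    ≡⟨ a-eq ⟩
  + 2 * ((+ 5 ℤ.+ m) * e₅ ℤ.+ (sX ℤ.+ (+ 2 ℤ.+ m) * (+ 2 * e₃e₂) ℤ.+ (+ 3 ℤ.+ m) * e₄e₁))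
    ≡⟨ solve 5 (λ m x s y z →
         con (+ 2) :* ((con (+ 5) :+ m) :* x :+ (s :+ (con (+ 2) :+ m) :* (con (+ 2) :* y) :+ (con (+ 3) :+ m) :* z))
         := con (+ 2) :* s :+ (con (+ 2) :* (con (+ 5) :+ m) :* x :+ con (+ 2) :* (con (+ 3) :+ m) :* z
              :+ con (+ 2) :* (con (+ 1) :+ m) :* y) :+ con (+ 2) :* ((con (+ 3) :+ m) :* y))
         refl m e₅ sX e₃e₂ e₄e₁ ⟩
  + 2 * sX ℤ.+ rest ℤ.+ + 2 * ((+ 3 ℤ.+ m) * e₃e₂)
    ≡⟨ cong (λ s → s ℤ.+ rest ℤ.+ + 2 * ((+ 3 ℤ.+ m) * e₃e₂)) s-eq ⟨
  (sA ℤ.+ + 2 * sE) ℤ.+ rest ℤ.+ + 2 * ((+ 3 ℤ.+ m) * e₃e₂)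
    ≡⟨ solve 4 (λ a s r y → (a :+ con (+ 2) :* s) :+ r :+ con (+ 2) :* y := a :+ r :+ con (+ 2) :* (y :+ s))
         refl sA sE rest ((+ 3 ℤ.+ m) * e₃e₂) ⟩
  sA ℤ.+ rest ℤ.+ + 2 * ((+ 3 ℤ.+ m) * e₃e₂ ℤ.+ sE) ∎)
  where
  open ≡-Reasoning
  rest = + 2 * (+ 5 ℤ.+ m) * e₅ ℤ.+ + 2 * (+ 3 ℤ.+ m) * e₄e₁ ℤ.+ + 2 * (+ 1 ℤ.+ m) * e₃e₂

-- The twin relation multiplied by c E. The factor `D`, later e_2, is moved to the front to agree
-- with the summands in `e₂⊗XP`.
weighted-relation : ∀ c E A D Y Z → A ⊕ (+ 2) ⊙ (D ⊗ Y) ≈ (+ 2) ⊙ Z →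
  c ⊙ E ⊗ A ⊕ (+ 2) ⊙ (D ⊗ (c ⊙ (E ⊗ Y))) ≈ (+ 2) ⊙ (c ⊙ (E ⊗ Z))
weighted-relation c E A D Y Z eq N α = begin
  (c ⊙ E ⊗ A) N α ℤ.+ + 2 * (D ⊗ (c ⊙ (E ⊗ Y))) N α
    ≡⟨ cong₂ (λ a b → a ℤ.+ + 2 * b) (⊙-⊗ c E A N α)
         (trans (⊗-⊙ c D (E ⊗ Y) N α) (cong (_*_ c) (⊗-leftComm D E Y N α))) ⟩
  c * (E ⊗ A) N α ℤ.+ + 2 * (c * (E ⊗ (D ⊗ Y)) N α)
    ≡⟨ solve 3 (λ c a b → c :* a :+ con (+ 2) :* (c :* b) := c :* (a :+ con (+ 2) :* b)) refl
         c ((E ⊗ A) N α) ((E ⊗ (D ⊗ Y)) N α) ⟩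
  c * ((E ⊗ A) N α ℤ.+ + 2 * (E ⊗ (D ⊗ Y)) N α)
    ≡⟨ cong (λ y → c * ((E ⊗ A) N α ℤ.+ y)) (⊗-⊙ (+ 2) E (D ⊗ Y) N α) ⟨
  c * ((E ⊗ A) N α ℤ.+ (E ⊗ ((+ 2) ⊙ (D ⊗ Y))) N α)
    ≡⟨ cong (_*_ c) (⊗-⊕ E A ((+ 2) ⊙ (D ⊗ Y)) N α) ⟨
  c * (E ⊗ (A ⊕ (+ 2) ⊙ (D ⊗ Y))) N α
    ≡⟨ cong (_*_ c) (trans (⊗-congˡ E eq N α) (⊗-⊙ (+ 2) E Z N α)) ⟩
  c * (+ 2 * (E ⊗ Z) N α)
    ≡⟨ solve 2 (λ c a → c :* (con (+ 2) :* a) := con (+ 2) :* (c :* a)) refl c ((E ⊗ Z) N α) ⟩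
  + 2 * (c * (E ⊗ Z) N α) ∎
  where open ≡-Reasoning

∑-relation : ∀ {A B C : ℕ → PowerSeries} m → (∀ i → i ℕ.< m → A i ⊕ (+ 2) ⊙ B i ≈ (+ 2) ⊙ C i) →
  ∑ᴾ (upTo m) A ⊕ (+ 2) ⊙ ∑ᴾ (upTo m) B ≈ (+ 2) ⊙ ∑ᴾ (upTo m) C
∑-relation {A} {B} {C} m eq N α = begin
  ∑ᴾ (upTo m) A N α ℤ.+ + 2 * ∑ᴾ (upTo m) B N α
    ≡⟨ cong (ℤ._+_ (∑ᴾ (upTo m) A N α)) (ℤ∑.*-∑ (upTo m) (+ 2) (λ i → B i N α)) ⟨
  ∑ᴾ (upTo m) A N α ℤ.+ ∑ᴾ (upTo m) (λ i → (+ 2) ⊙ B i) N α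
    ≡⟨ ℤ∑.∑-+ (upTo m) (λ i → A i N α) (λ i → + 2 * B i N α) ⟨
  ∑ᴾ (upTo m) (λ i → A i ⊕ (+ 2) ⊙ B i) N α
    ≡⟨ ℤ∑.∑-upTo-cong m (λ i i<m → eq i i<m N α) ⟩
  ∑ᴾ (upTo m) (λ i → (+ 2) ⊙ C i) N α
    ≡⟨ ℤ∑.*-∑ (upTo m) (+ 2) (λ i → C i N α) ⟩
  + 2 * ∑ᴾ (upTo m) C N α ∎
  where open ≡-Reasoning

module _ (v : EndVertices) where
  open EndVertices v

  XPᵥ-relation : ∀ n → XPᵥ v (suc n) ⊕ (+ 2) ⊙ (e 2 ⊗ XP n) ≈ (+ 2) ⊙ XP (2 + n)
  XPᵥ-relation n = twin-relation n (vertex (suc n)) (isEnd (suc n))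

  XPᵥ-formula : ∀ m → XPᵥ v (2 + m) ≈
    (+ 2 * + (3 + m)) ⊙ e (3 + m) ⊕ (+ 2) ⊙ ∑ᴾ (upTo m) (λ i → (+ (2 + i)) ⊙ (e (3 + i) ⊗ XP (m ∸ i)))
  XPᵥ-formula m = twin-formula m (vertex (2 + m)) (isEnd (2 + m))

  XPᵥ-1 : XPᵥ v 1 ≈ (+ 2) ⊙ e 2
  XPᵥ-1 = twin-1 (vertex 1) (isEnd 1)

  XPᵥ-2 : XPᵥ v 2 ≈ (+ 6) ⊙ e 3
  XPᵥ-2 N α = trans (XPᵥ-formula 0 N α) (ℤ.+-identityʳ _)

  XPᵥ-3 : XPᵥ v 3 ≈ (+ 8) ⊙ e 4 ⊕ (+ 4) ⊙ (e 3 ⊗ e 1)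
  XPᵥ-3 N α = trans (XPᵥ-formula 1 N α)
    (trans (cong (λ y → + 8 * e 4 N α ℤ.+ + 2 * (+ 2 * y ℤ.+ 0ℤ)) (⊗-congˡ (e 3) XP-1 N α))
      (solve 2 (λ x y → con (+ 8) :* x :+ con (+ 2) :* (con (+ 2) :* y :+ con 0ℤ) := con (+ 8) :* x :+ con (+ 4) :* y)
        refl (e 4 N α) ((e 3 ⊗ e 1) N α)))

  XPᵥ-EPositive : ∀ n → 1 ≤ n → EPositive (XPᵥ v n)
  XPᵥ-EPositive (suc zero)    _ = ECombinable⇒EPositive (ECombinable-≈ XPᵥ-1 (ECombinable-⊙ 2 (ECombinable-e 1)))
  XPᵥ-EPositive (suc (suc m)) _ = ECombinable⇒EPositive (ECombinable-≈ (XPᵥ-formula m)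
    (ECombinable-⊕ (ECombinable-⊙ (2 ℕ.* (3 + m)) (ECombinable-e (2 + m)))
      (ECombinable-⊙ 2 (ECombinable-∑ (upTo m) (λ i →
        ECombinable-⊙ (2 + i) (ECombinable-e⊗ (2 + i) (XP-ECombinable (m ∸ i))))))))

  XPᵥ-expansion : ∀ n → 4 ≤ n → XPᵥ v n ≈
    (+ 2 * + (n + 1)) ⊙ e (n + 1) ⊕ (+ 2) ⊙ (∑[ j from 3 to n ] ((+ j - + 1) ⊙ e j ⊗ XP (n + 1 ∸ j)))
  -- For n = 2 + m and j = 3 + i, the index `n + 1 ∸ j` becomes `m ∸ i` once m + 1 is rewritten as a
  -- successor.
  XPᵥ-expansion (suc (suc m)) (ℕ.s≤s (ℕ.s≤s _)) N α rewrite ℕ.+-comm m 1 = trans (XPᵥ-formula m N α)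
    (cong (λ s → + 2 * + (3 + m) * e (3 + m) N α ℤ.+ + 2 * s) (trans
      (ℤ∑.∑-cong (upTo m) (λ i → sym (⊙-⊗ (+ (2 + i)) (e (3 + i)) (XP (m ∸ i)) N α)))
      (sym (foldr-map-∑ (λ i → ((+ (2 + i)) ⊙ e (3 + i) ⊗ XP (m ∸ i)) N α) (upTo m)))))

  -- The bound keeps the index `suc m ∸ i` positive; at index 0 the value of `XPᵥ` is a dummy and
  -- the relation has no meaning. This is why the sums are compared only within their range.
  XPᵥ-relation-∸ : ∀ m i → i ≤ m → XPᵥ v (suc m ∸ i) ⊕ (+ 2) ⊙ (e 2 ⊗ XP (m ∸ i)) ≈ (+ 2) ⊙ XP (2 + m ∸ i)
  XPᵥ-relation-∸ m i i≤m = subst (λ k → XPᵥ v k ⊕ (+ 2) ⊙ (e 2 ⊗ XP (m ∸ i)) ≈ (+ 2) ⊙ XP (2 + m ∸ i))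
    (sym (ℕ.+-∸-assoc 1 i≤m))
    (subst (λ k → XPᵥ v (suc (m ∸ i)) ⊕ (+ 2) ⊙ (e 2 ⊗ XP (m ∸ i)) ≈ (+ 2) ⊙ XP k)
      (sym (ℕ.+-∸-assoc 2 i≤m)) (XPᵥ-relation (m ∸ i)))

  ∑-weighted-relation : ∀ m →
    ∑ᴾ (upTo m) (λ i → (+ (1 + i)) ⊙ e (2 + i) ⊗ XPᵥ v (suc m ∸ i))
      ⊕ (+ 2) ⊙ ∑ᴾ (upTo m) (λ i → e 2 ⊗ ((+ (1 + i)) ⊙ (e (2 + i) ⊗ XP (m ∸ i))))
      ≈ (+ 2) ⊙ ∑ᴾ (upTo m) (λ i → (+ (1 + i)) ⊙ (e (2 + i) ⊗ XP (2 + m ∸ i)))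
  ∑-weighted-relation m = ∑-relation m (λ i i<m →
    weighted-relation (+ (1 + i)) (e (2 + i)) (XPᵥ v (suc m ∸ i)) (e 2) (XP (m ∸ i)) (XP (2 + m ∸ i))
      (XPᵥ-relation-∸ m i (ℕ.<⇒≤ i<m)))

  XPᵥ-recurrence : ∀ n → 4 ≤ n → XPᵥ v n ≈
    (∑[ j from 2 to (n ∸ 2) ] ((+ j - + 1) ⊙ e j ⊗ XPᵥ v (n ∸ j)))
      ⊕ ( (+ 2 * + (n + 1)) ⊙ e (n + 1)
        ⊕ (+ 2 * (+ n - + 1)) ⊙ (e n ⊗ e 1)
        ⊕ (+ 2 * (+ n - + 3)) ⊙ (e (n ∸ 1) ⊗ e 2))
  XPᵥ-recurrence (suc (suc (suc (suc m)))) (ℕ.s≤s (ℕ.s≤s (ℕ.s≤s (ℕ.s≤s _)))) N α = begin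
    XPᵥ v (4 + m) N α
      ≡⟨ recurrence-from-relations (+ m) _ _ _ (e (5 + m) N α) ((e (4 + m) ⊗ e 1) N α) ((e (3 + m) ⊗ e 2) N α) (∑ᴾ is A N α)
           (∑ᴾ is (λ i → e 2 ⊗ ((+ (1 + i)) ⊙ (e (2 + i) ⊗ XP (1 + m ∸ i)))) N α)
           (∑ᴾ is (λ i → (+ (1 + i)) ⊙ (e (2 + i) ⊗ XP (3 + m ∸ i))) N α)
           (XPᵥ-relation (3 + m) N α) (XP-top-terms m N α) (e₂⊗XP (1 + m) N α) (∑-weighted-relation (1 + m) N α) ⟩
    ∑ᴾ is A N α ℤ.+ rest (5 + m)
      ≡⟨ cong₂ ℤ._+_ (foldr-map-∑ (λ i → A i N α) is) (cong rest (ℕ.+-comm (4 + m) 1)) ⟨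
    (∑[ j from 2 to (2 + m) ] ((+ j - + 1) ⊙ e j ⊗ XPᵥ v (4 + m ∸ j))) N α ℤ.+ rest (4 + m + 1) ∎
    where
    open ≡-Reasoning
    is = upTo (1 + m)
    A : ℕ → PowerSeries
    A i = (+ (1 + i)) ⊙ e (2 + i) ⊗ XPᵥ v (2 + m ∸ i)
    -- The parameter allows the index 5 + m of the relations to be exchanged for the 4 + m + 1 of
    -- the goal, in the coefficient and in `e` at once.
    rest : ℕ → ℤ
    rest p = + 2 * + p * e p N α ℤ.+ + 2 * + (3 + m) * (e (4 + m) ⊗ e 1) N α ℤ.+ + 2 * + (1 + m) * (e (3 + m) ⊗ e 2) N α

-- e-positivity of the ingredients of the recurrence

multiplier-EPositive : ∀ j → 2 ≤ j → EPositive ((+ j - + 1) ⊙ e j)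
multiplier-EPositive (suc (suc i)) (ℕ.s≤s (ℕ.s≤s _)) = ECombinable⇒EPositive (ECombinable-⊙ (1 + i) (ECombinable-e (1 + i)))

inhomogeneous-EPositive : ∀ n → 4 ≤ n → EPositive
  ( (+ 2 * + (n + 1)) ⊙ e (n + 1)
  ⊕ (+ 2 * (+ n - + 1)) ⊙ (e n ⊗ e 1)
  ⊕ (+ 2 * (+ n - + 3)) ⊙ (e (n ∸ 1) ⊗ e 2))
inhomogeneous-EPositive (suc (suc (suc (suc m)))) (ℕ.s≤s (ℕ.s≤s (ℕ.s≤s (ℕ.s≤s _)))) = ECombinable⇒EPositive
  (ECombinable-⊕
    (ECombinable-⊕ (ECombinable-⊙ (2 ℕ.* (4 + m + 1)) (ECombinable-e (3 + m + 1)))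
                   (ECombinable-⊙ (2 ℕ.* (3 + m)) (ECombinable-e⊗ (3 + m) (ECombinable-e 0))))
    (ECombinable-⊙ (2 ℕ.* (1 + m)) (ECombinable-e⊗ (2 + m) (ECombinable-e 1))))

proposition4p2 : (v : EndVertices) →
    ((n : ℕ) → 4 ≤ n →
    XPᵥ v n
    ≈ (+ 2 * + (n + 1)) ⊙ e (n + 1)
    ⊕ (+ 2) ⊙ (∑[ j from 3 to n ] ((+ j - + 1) ⊙ e j ⊗ XP (n + 1 ∸ j))))
    × ((n : ℕ) → 1 ≤ n → EPositive (XPᵥ v n))
    × ((n : ℕ) → 4 ≤ n →
    XPᵥ v n
    ≈ (∑[ j from 2 to (n ∸ 2) ] ((+ j - + 1) ⊙ e j ⊗ XPᵥ v (n ∸ j)))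
    ⊕ ( (+ 2 * + (n + 1)) ⊙ e (n + 1)
    ⊕ (+ 2 * (+ n - + 1)) ⊙ (e n ⊗ e 1)
    ⊕ (+ 2 * (+ n - + 3)) ⊙ (e (n ∸ 1) ⊗ e 2)))
    × ((n : ℕ) → 4 ≤ n →
    ((j : ℕ) → 2 ≤ j → j ≤ n ∸ 2 → EPositive ((+ j - + 1) ⊙ e j))
    × EPositive ( (+ 2 * + (n + 1)) ⊙ e (n + 1)
    ⊕ (+ 2 * (+ n - + 1)) ⊙ (e n ⊗ e 1)
    ⊕ (+ 2 * (+ n - + 3)) ⊙ (e (n ∸ 1) ⊗ e 2)))
    × XPᵥ v 1 ≈ (+ 2) ⊙ e 2
    × XPᵥ v 2 ≈ (+ 6) ⊙ e 3
    × XPᵥ v 3 ≈ (+ 8) ⊙ e 4 ⊕ (+ 4) ⊙ (e 3 ⊗ e 1)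
proposition4p2 v =
  XPᵥ-expansion v , XPᵥ-EPositive v , XPᵥ-recurrence v ,
  (λ n 4≤n → (λ j 2≤j _ → multiplier-EPositive j 2≤j) , inhomogeneous-EPositive n 4≤n) ,
  XPᵥ-1 v , XPᵥ-2 v , XPᵥ-3 v
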